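{- Let $G$ be a finite group (written multiplicatively) and let $S\subseteq G$ be a subset for which there exists a subset $T\subseteq G$ such that $2\le |T|$ and $|TS|\le \min(|G|-2,\ |T|+|S|-1)$. Then at least one of the following holds: (i) $S$ is a geometric progression, i.e. there exist $g,a\in G$ such that one of the two sets $gS$, $Sg$ equals $\{1,a,a^2,\ldots,a^{|S|-1}\}$; (ii) there exist a non-trivial proper subgroup $H$ of $G$ and $\varepsilon\in\{1,-1\}$ such that $|HS^{\varepsilon}|\le |H|+|S|-1$; (iii) there exist a subgroup $H$ of $G$, an element $a\in G$ and $\varepsilon\in\{1,-1\}$ such that $|HaH|=|H|^2$ and, letting $A=H\cup Ha$, $$|AS^{\varepsilon}|=|A|+|S|-1=|G|-|A|.$$
   Context: For subsets $X,Y$ of a group, $XY=\{xy: x\in X, y\in Y\}$. $S^{1}=S$ and $S^{ -1}=\{s^{ -1}: s\in S\}$. -}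

module Defs where

open import Algebra.Bundles using (Group)
import Algebra.Definitions.RawMonoid as RawMonoidDefinitions
open import Data.Fin.Base using (Fin; toℕ)
open import Data.Fin.Properties using (any?; _≟_)
open import Data.Fin.Subset using (Subset; ⁅_⁆; ⊤; _∈_; ∣_∣)
open import Data.Fin.Subset.Properties using (_∈?_)
open import Data.Nat.Base using (ℕ)
open import Data.Product.Base using (∃₂)
open import Data.Sign.Base as Sign using (Sign)
open import Data.Sum.Base using (_⊎_)
open import Data.Vec.Base using (tabulate)
open import Function.Bundles using (Inverse)
open import Level using (suc; _⊔_)
open import Relation.Binary.PropositionalEquality.Core using (_≡_; _≢_)
open import Relation.Binary.PropositionalEquality.Properties using (setoid)
open import Relation.Nullary.Decidable.Core using (Dec; does; _×-dec_)

record FiniteGroup c ℓ : Set (suc (c ⊔ ℓ)) where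
  field
    group       : Group c ℓ
    order       : ℕ
    enumeration : Inverse (Group.setoid group) (setoid (Fin order))

comprehension : ∀ {n p} {P : Fin n → Set p} → (∀ i → Dec (P i)) → Subset n
comprehension P? = tabulate (λ i → does (P? i))

-- A subset of G is given by the set of indices of its elements, so that
-- propositional equality of subsets is extensional and ∣_∣ is cardinality.

module FiniteGroupSubsets {c ℓ} (G : FiniteGroup c ℓ) where

  open FiniteGroup G public using (order)
  open Group (FiniteGroup.group G) public using (Carrier; _∙_; ε; _⁻¹; rawMonoid)
  open Inverse (FiniteGroup.enumeration G) public
    using () renaming (to to index; from to element)
  open RawMonoidDefinitions rawMonoid using () renaming (_×_ to _times_)

  infixr 8 _^_
  infixl 7 _·_
  infix  8 _^ˢ_

  _^_ : Carrier → ℕ → Carrier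
  a ^ k = k times a

  GSubset : Set
  GSubset = Subset order

  ｛_｝ : Carrier → GSubset
  ｛ a ｝ = ⁅ index a ⁆

  _·_ : GSubset → GSubset → GSubset
  X · Y = comprehension λ k → any? λ i → any? λ j →
    (i ∈? X) ×-dec (j ∈? Y) ×-dec (k ≟ index (element i ∙ element j))

  inverses : GSubset → GSubset
  inverses X = comprehension λ k → any? λ i →
    (i ∈? X) ×-dec (k ≟ index (element i ⁻¹))

  _^ˢ_ : GSubset → Sign → GSubset
  X ^ˢ Sign.+ = X
  X ^ˢ Sign.- = inverses X

  -- The set {1, a, …, aᵐ⁻¹}, empty when m = 0.
  powers : Carrier → ℕ → GSubset
  powers a m = comprehension λ k → any? λ (i : Fin m) → k ≟ index (a ^ toℕ i)

  record IsSubgroup (H : GSubset) : Set c where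
    field
      ε∈        : index ε ∈ H
      ∙-closed  : ∀ x y → index x ∈ H → index y ∈ H → index (x ∙ y) ∈ H
      ⁻¹-closed : ∀ x → index x ∈ H → index (x ⁻¹) ∈ H

  IsNontrivial : GSubset → Set
  IsNontrivial H = H ≢ ｛ ε ｝

  IsProper : GSubset → Set
  IsProper H = H ≢ ⊤

  IsGeometricProgression : GSubset → Set c
  IsGeometricProgression S = ∃₂ λ g a →
    (｛ g ｝ · S ≡ powers a ∣ S ∣) ⊎ (S · ｛ g ｝ ≡ powers a ∣ S ∣)

{-# OPTIONS --safe #-}
module Submission where

-- The proof is by the isoperimetric method. Call X admissible if |X| ≥ 2 and
-- |XS| ≤ |G| - 2, and let κ be the minimum of |XS| - |X| over the admissible X, so that
-- κ ≤ |S| - 1 by hypothesis. A fragment is an admissible X attaining κ. Left translates of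
-- fragments are fragments, and the complement of XS is a fragment for S⁻¹ with the same
-- κ (module Dual). Let A be a smallest fragment among all those for S and S⁻¹;
-- by symmetry it belongs to S, and it may be translated to contain 1.
--
-- Since |XS| is a submodular function of X, a translate gA that meets a fragment X
-- in at least two points lies inside X (meet-twice⇒⊆): otherwise the intersection,
-- being smaller than A, would have excess above κ, which would push the union
-- below κ. The last step is legitimate because |XS| ≥ |X| + κ holds for every nonempty X
-- with XS ≠ G (nonempty-bound), and the union is small enough for this since
-- |A| + |XS| ≤ |G| by the choice of A. There are three cases.
--
-- If |A| = 2, then |S ∪ αS| ≤ |S| + 1 for some α ≠ 1. So S is the union of a set R with
-- αR = R and at most one further α-progression; it is a progression if R is empty, and
-- the stabiliser of R gives conclusion (ii) otherwise (module AlmostPeriodic).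
--
-- If κ < |S| - 1, one common point is already enough, the translates of A partition
-- the group, and A is a subgroup (non-extremal).
--
-- The main case is κ = |S| - 1 and |A| ≥ 3 (module ExtremalAtom). Let H be the left
-- stabiliser of A. If A = H then (ii) holds; otherwise 2|H| ≤ |A|. Adjoin to A, one after
-- another, translates of A that meet the union X so far in a single point; X stays a
-- fragment as long as |A| + |XS| < |G| before each step. If at some point there is no
-- such translate, X contains every translate it meets, and is a subgroup as in (ii).
-- Otherwise a union X of i + 1 translates with |A| + |XS| = |G| is reached. It has
-- (i + 1)|A| - i elements and contains exactly the i + 1 translates used. Fix y outside
-- XS. For each of the |X| elements z outside AS, the translate yz⁻¹A
-- and X both lie in a set of |A| + |X| - 1 elements; those of these translates that are
-- not inside X fill the rest of that set, so they coincide. Hence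
-- |X| ≤ (i + 2)|H| (maximal-bound), which with 2|H| ≤ |A| and |A| ≥ 3 forces i = 0 and
-- |A| = 2|H|. So A = H ∪ Hx, |G| = 2|A| + |S| - 1, and |HxH| = |H|² because A and x⁻¹A
-- meet only in 1. This is (iii).

open import Defs
open import Algebra.Bundles using (Group)
open import Algebra.Structures using (IsGroup)
import Algebra.Properties.Group as GroupProperties
open import Data.Bool.Base using (true)
open import Data.Empty using (⊥-elim)
open import Data.Fin.Base using (Fin; zero; suc; toℕ; fromℕ<; combine; remQuot)
open import Data.Fin.Properties as Fin
  using (any?; _≟_; toℕ<n; toℕ-fromℕ<; pigeonhole; injective⇒≤; combine-injective; combine-remQuot)
open import Data.Fin.Subset
  using (Subset; _∪_; _∩_; ∣_∣; ⊤; ∁; ⁅_⁆; _∈_; _∉_; _⊆_; Nonempty; inside; outside)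
open import Data.Fin.Subset.Properties
  using ( _∈?_; _⊆?_; anySubset?; ∣p∣≤n; ∣⊤∣≡n; ∣⁅x⁆∣≡1; ⊆-antisym; p⊆q⇒∣p∣≤∣q∣
        ; p⊂q⇒∣p∣<∣q∣; p⊆p∪q; q⊆p∪q; p∩q⊆p; p∩q⊆q; x∈p∩q⁺; x∈p∩q⁻; x∈p∪q⁺; x∈p∪q⁻
        ; x∈⁅x⁆; x∈⁅y⁆⇒x≡y; x∈∁p⇒x∉p; x∉p⇒x∈∁p; nonempty?)
open import Data.Nat.Base using (ℕ; zero; suc; _+_; _∸_; _*_; _⊓_; _≤_; _<_; z≤n; s≤s)
open import Data.Nat.Induction using (<-wellFounded)
open import Data.Nat.Properties as ℕ
  using (≤-refl; ≤-trans; ≤-reflexive; ≤-antisym; _≤?_; _<?_; ≰⇒>; ≮⇒≥; +-mono-≤; +-monoˡ-≤; +-monoʳ-≤)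
open import Data.Nat.Solver using (module +-*-Solver)
open import Data.Product.Base using (_×_; _,_; ∃; ∃-syntax; ∃₂; proj₁; proj₂)
import Data.Sign.Base as Sign
open import Data.Sum.Base using (_⊎_; inj₁; inj₂; [_,_]′)
open import Data.Vec.Base using (_∷_; []; here; there)
open import Data.Vec.Properties using ([]=⇒lookup; lookup⇒[]=; lookup∘tabulate)
open import Function.Base using (_∘_)
open import Function.Bundles using (Inverse)
open import Induction.WellFounded using (Acc; acc)
open import Level using (0ℓ)
open import Relation.Binary.PropositionalEquality.Core using (_≡_; _≢_; refl; sym; trans; cong; cong₂; subst)
open import Relation.Binary.PropositionalEquality.Properties using (isEquivalence; module ≡-Reasoning)
open import Relation.Nullary.Decidable.Core using (Dec; yes; no; does; _×-dec_; ¬?)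
open import Relation.Nullary.Negation.Core using (¬_; contradiction)
open import Relation.Binary.Definitions using (tri<; tri≈; tri>)
open import Relation.Unary using (Decidable)

open +-*-Solver using (solve; _:+_; _:*_; _:=_; con)

-- Linear inequalities between cardinalities.

-- An inequality x ≤ y holds if adding some known inequality l ≤ r to its reverse
-- leaves an identity.
≤-by-adding : ∀ {l r} x y → l ≤ r → x + r ≡ y + l → x ≤ y
≤-by-adding {l} {r} x y l≤r eq = ℕ.+-cancelʳ-≤ r x y (begin
  x + r  ≡⟨ eq ⟩
  y + l  ≤⟨ +-monoʳ-≤ y l≤r ⟩
  y + r  ∎)
  where open ℕ.≤-Reasoning

-- In the lemmas below us, is, as, xs, ys and zs stand for |US|, |IS|, |AS| and so on, where
-- I is the intersection and U the union of a translate of A with X; a single letter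
-- stands for the size of the set itself, cx for that of the complement of X, and n
-- for the order of the group.

overlap-arithmetic : ∀ {us is as xs u i x a κ} → us + is ≤ as + xs → as ≤ a + κ → xs ≤ x + κ → u + i ≡ a + x → u + κ ≤ us →
  is ≤ i + κ
overlap-arithmetic {us} {is} {as} {xs} {u} {i} {x} {a} {κ} h₁ h₂ h₃ h₄ h₅ = ≤-by-adding is (i + κ)
  (+-mono-≤ (+-mono-≤ (+-mono-≤ (+-mono-≤ h₁ h₂) h₃) (≤-reflexive (sym h₄))) h₅)
  (solve 9 (λ us is as xs u i x a κ →
    is :+ ((as :+ xs) :+ (a :+ κ) :+ (x :+ κ) :+ (u :+ i) :+ us)
    := (i :+ κ) :+ ((us :+ is) :+ as :+ xs :+ (a :+ x) :+ (u :+ κ))) refl us is as xs u i x a κ)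

room-arithmetic : ∀ {us is as xs i a κ n} → us + is ≤ as + xs → as ≤ a + κ → a + xs ≤ n → 1 + (i + κ) ≤ is →
  1 + (us + i) ≤ n
room-arithmetic {us} {is} {as} {xs} {i} {a} {κ} {n} h₁ h₂ h₃ h₄ = ≤-by-adding (1 + (us + i)) n
  (+-mono-≤ (+-mono-≤ (+-mono-≤ h₁ h₂) h₃) h₄)
  (solve 8 (λ us is as xs i a κ n →
    (con 1 :+ (us :+ i)) :+ ((as :+ xs) :+ (a :+ κ) :+ n :+ is)
    := n :+ ((us :+ is) :+ as :+ (a :+ xs) :+ (con 1 :+ (i :+ κ)))) refl us is as xs i a κ n)

join-room-arithmetic : ∀ {us is as xs a κ} → us + is ≤ as + xs → as ≤ a + κ → 1 + κ ≤ is →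
  1 + us ≤ a + xs
join-room-arithmetic {us} {is} {as} {xs} {a} {κ} h₁ h₂ h₃ = ≤-by-adding (1 + us) (a + xs)
  (+-mono-≤ (+-mono-≤ h₁ h₂) h₃)
  (solve 6 (λ us is as xs a κ →
    (con 1 :+ us) :+ ((as :+ xs) :+ (a :+ κ) :+ is)
    := (a :+ xs) :+ ((us :+ is) :+ as :+ (con 1 :+ κ))) refl us is as xs a κ)

join-tight-arithmetic : ∀ {us is as xs u x a κ} → us + is ≤ as + xs → as ≤ a + κ → 1 + κ ≤ is → u + 1 ≡ a + x → xs ≤ x + κ →
  us ≤ u + κ
join-tight-arithmetic {us} {is} {as} {xs} {u} {x} {a} {κ} h₁ h₂ h₃ h₄ h₅ = ≤-by-adding us (u + κ)
  (+-mono-≤ (+-mono-≤ (+-mono-≤ (+-mono-≤ h₁ h₂) h₃) (≤-reflexive (sym h₄))) h₅)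
  (solve 8 (λ us is as xs u x a κ →
    us :+ ((as :+ xs) :+ (a :+ κ) :+ is :+ (u :+ con 1) :+ (x :+ κ))
    := (u :+ κ) :+ ((us :+ is) :+ as :+ (con 1 :+ κ) :+ (a :+ x) :+ xs)) refl us is as xs u x a κ)

complement-arithmetic : ∀ {as d a x xs κ n} → as + d ≡ n → a + xs ≡ n → x + κ ≤ xs → as ≤ a + κ →
  x ≤ d
complement-arithmetic {as} {d} {a} {x} {xs} {κ} {n} h₁ h₂ h₃ h₄ = ≤-by-adding x d
  (+-mono-≤ (+-mono-≤ (+-mono-≤ (≤-reflexive (sym h₁)) (≤-reflexive h₂)) h₃) h₄)
  (solve 7 (λ as d a x xs κ n →
    x :+ ((as :+ d) :+ n :+ xs :+ (a :+ κ))
    := d :+ (n :+ (a :+ xs) :+ (x :+ κ) :+ as)) refl as d a x xs κ n)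

window-arithmetic : ∀ {c s a x xs κ n} → c + s ≡ n → a + xs ≡ n → xs ≤ x + κ → 1 + κ ≤ s →
  1 + c ≤ a + x
window-arithmetic {c} {s} {a} {x} {xs} {κ} {n} h₁ h₂ h₃ h₄ = ≤-by-adding (1 + c) (a + x)
  (+-mono-≤ (+-mono-≤ (+-mono-≤ (≤-reflexive h₁) (≤-reflexive (sym h₂))) h₃) h₄)
  (solve 7 (λ c s a x xs κ n →
    (con 1 :+ c) :+ (n :+ (a :+ xs) :+ (x :+ κ) :+ s)
    := (a :+ x) :+ ((c :+ s) :+ n :+ xs :+ (con 1 :+ κ))) refl c s a x xs κ n)

window-full-arithmetic : ∀ {w u i a x} → 1 + w ≤ a + x → u + i ≡ a + x → i ≤ 1 →
  w ≤ u
window-full-arithmetic {w} {u} {i} {a} {x} h₁ h₂ h₃ = ≤-by-adding w u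
  (+-mono-≤ (+-mono-≤ h₁ (≤-reflexive (sym h₂))) h₃)
  (solve 5 (λ w u i a x →
    w :+ ((a :+ x) :+ (u :+ i) :+ con 1)
    := u :+ ((con 1 :+ w) :+ (a :+ x) :+ i)) refl w u i a x)

dual-lower-arithmetic : ∀ {z κ zs y cy ys n} → z + κ ≤ zs → zs ≤ cy → y + cy ≡ n → ys + z ≡ n →
  y + κ ≤ ys
dual-lower-arithmetic {z} {κ} {zs} {y} {cy} {ys} {n} h₁ h₂ h₃ h₄ = ≤-by-adding (y + κ) ys
  (+-mono-≤ (+-mono-≤ (+-mono-≤ h₁ h₂) (≤-reflexive h₃)) (≤-reflexive (sym h₄)))
  (solve 7 (λ z κ zs y cy ys n →
    (y :+ κ) :+ (zs :+ cy :+ n :+ (ys :+ z))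
    := ys :+ ((z :+ κ) :+ zs :+ (y :+ cy) :+ n)) refl z κ zs y cy ys n)

dual-tight-arithmetic : ∀ {z κ zs x cx xs n} → zs ≤ cx → x + cx ≡ n → xs + z ≡ n → xs ≤ x + κ →
  zs ≤ z + κ
dual-tight-arithmetic {z} {κ} {zs} {x} {cx} {xs} {n} h₁ h₂ h₃ h₄ = ≤-by-adding zs (z + κ)
  (+-mono-≤ (+-mono-≤ (+-mono-≤ h₁ (≤-reflexive h₂)) (≤-reflexive (sym h₃))) h₄)
  (solve 7 (λ z κ zs x cx xs n →
    zs :+ (cx :+ n :+ (xs :+ z) :+ (x :+ κ))
    := (z :+ κ) :+ (zs :+ (x :+ cx) :+ n :+ xs)) refl z κ zs x cx xs n)

dual-size-arithmetic : ∀ {xs z n} → 2 + xs ≤ n → xs + z ≡ n →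
  2 ≤ z
dual-size-arithmetic {xs} {z} {n} h₁ h₂ = ≤-by-adding 2 z
  (+-mono-≤ h₁ (≤-reflexive (sym h₂)))
  (solve 3 (λ xs z n →
    con 2 :+ (n :+ (xs :+ z))
    := z :+ ((con 2 :+ xs) :+ n)) refl xs z n)

dual-room-arithmetic : ∀ {zs x cx n} → zs ≤ cx → x + cx ≡ n → 2 ≤ x →
  2 + zs ≤ n
dual-room-arithmetic {zs} {x} {cx} {n} h₁ h₂ h₃ = ≤-by-adding (2 + zs) n
  (+-mono-≤ (+-mono-≤ h₁ (≤-reflexive h₂)) h₃)
  (solve 4 (λ zs x cx n →
    (con 2 :+ zs) :+ (cx :+ n :+ x)
    := n :+ (zs :+ (x :+ cx) :+ con 2)) refl zs x cx n)

coleast-arithmetic : ∀ {a z xs n} → a ≤ z → xs + z ≡ n →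
  a + xs ≤ n
coleast-arithmetic {a} {z} {xs} {n} h₁ h₂ = ≤-by-adding (a + xs) n
  (+-mono-≤ h₁ (≤-reflexive h₂))
  (solve 4 (λ a z xs n →
    (a :+ xs) :+ (z :+ n)
    := n :+ (a :+ (xs :+ z))) refl a z xs n)

-- Here x is the size of a tree of i + 1 translates of A. Doubling the bound on x and
-- using 2h ≤ a gives 2(i + 1)a - 2i ≤ (i + 2)a.
tree-arithmetic : ∀ {i x a h} → x + i ≡ suc i * a → x ≤ (2 + i) * h → h + h ≤ a → i * a ≤ i * 2
tree-arithmetic {i} {x} {a} {h} size bound 2h≤a = ≤-by-adding (i * a) (i * 2)
  (+-mono-≤ (+-mono-≤ (+-mono-≤ size′ size′) (+-mono-≤ bound bound)) (ℕ.*-monoʳ-≤ (2 + i) 2h≤a))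
  (solve 4 (λ i x a h →
    i :* a :+ (x :+ i :+ (x :+ i) :+ ((con 2 :+ i) :* h :+ (con 2 :+ i) :* h) :+ (con 2 :+ i) :* a)
    := i :* con 2 :+ ((con 1 :+ i) :* a :+ (con 1 :+ i) :* a :+ (x :+ x) :+ (con 2 :+ i) :* (h :+ h))) refl i x a h)
  where
  size′ : suc i * a ≤ x + i
  size′ = ≤-reflexive (sym size)

-- Cardinalities of finite sets.

private variable
  n : ℕ
  p q : Subset n

module _ {ℓ} {P : Fin n → Set ℓ} (P? : ∀ i → Dec (P i)) where

  ∈-comprehension⁺ : ∀ {i} → P i → i ∈ comprehension P?
  ∈-comprehension⁺ {i} Pi = lookup⇒[]= i _ (trans (lookup∘tabulate _ i) eq)
    where
    eq : does (P? i) ≡ true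
    eq with P? i
    ... | yes _ = refl
    ... | no ¬Pi = contradiction Pi ¬Pi

  ∈-comprehension⁻ : ∀ {i} → i ∈ comprehension P? → P i
  ∈-comprehension⁻ {i} i∈ with P? i | trans (sym (lookup∘tabulate (does ∘ P?) i)) ([]=⇒lookup i∈)
  ... | yes Pi | _  = Pi
  ... | no _   | ()

∣p∪q∣+∣p∩q∣≡∣p∣+∣q∣ : ∀ {n} (p q : Subset n) → ∣ p ∪ q ∣ + ∣ p ∩ q ∣ ≡ ∣ p ∣ + ∣ q ∣
∣p∪q∣+∣p∩q∣≡∣p∣+∣q∣ []            []            = refl
∣p∪q∣+∣p∩q∣≡∣p∣+∣q∣ (outside ∷ p) (outside ∷ q) = ∣p∪q∣+∣p∩q∣≡∣p∣+∣q∣ p q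
∣p∪q∣+∣p∩q∣≡∣p∣+∣q∣ (outside ∷ p) (inside ∷ q)  =
  trans (cong suc (∣p∪q∣+∣p∩q∣≡∣p∣+∣q∣ p q)) (sym (ℕ.+-suc _ _))
∣p∪q∣+∣p∩q∣≡∣p∣+∣q∣ (inside ∷ p)  (outside ∷ q) = cong suc (∣p∪q∣+∣p∩q∣≡∣p∣+∣q∣ p q)
∣p∪q∣+∣p∩q∣≡∣p∣+∣q∣ (inside ∷ p)  (inside ∷ q)  =
  cong suc (trans (ℕ.+-suc _ _) (trans (cong suc (∣p∪q∣+∣p∩q∣≡∣p∣+∣q∣ p q)) (sym (ℕ.+-suc _ _))))

∣p∪q∣≤∣p∣+∣q∣ : ∀ (p q : Subset n) → ∣ p ∪ q ∣ ≤ ∣ p ∣ + ∣ q ∣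
∣p∪q∣≤∣p∣+∣q∣ p q = ≤-trans (ℕ.m≤m+n _ _) (≤-reflexive (∣p∪q∣+∣p∩q∣≡∣p∣+∣q∣ p q))

∣p∣+∣∁p∣≡n : ∀ {n} (p : Subset n) → ∣ p ∣ + ∣ ∁ p ∣ ≡ n
∣p∣+∣∁p∣≡n []            = refl
∣p∣+∣∁p∣≡n (inside ∷ p)  = cong suc (∣p∣+∣∁p∣≡n p)
∣p∣+∣∁p∣≡n (outside ∷ p) = trans (ℕ.+-suc _ _) (cong suc (∣p∣+∣∁p∣≡n p))

-- The increasing enumeration of a subset, and the position of an element.
nth : ∀ {n} (p : Subset n) → Fin ∣ p ∣ → Fin n
nth (inside ∷ p)  zero    = zero
nth (inside ∷ p)  (suc i) = suc (nth p i)
nth (outside ∷ p) i       = suc (nth p i)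

nth∈ : ∀ {n} (p : Subset n) i → nth p i ∈ p
nth∈ (inside ∷ p)  zero    = here
nth∈ (inside ∷ p)  (suc i) = there (nth∈ p i)
nth∈ (outside ∷ p) i       = there (nth∈ p i)

nth-injective : ∀ {n} (p : Subset n) {i j} → nth p i ≡ nth p j → i ≡ j
nth-injective (inside ∷ p)  {zero}  {zero}  eq = refl
nth-injective (inside ∷ p)  {suc i} {suc j} eq = cong suc (nth-injective p (Fin.suc-injective eq))
nth-injective (outside ∷ p) eq = nth-injective p (Fin.suc-injective eq)

rank : ∀ {n} {p : Subset n} {x} → x ∈ p → Fin ∣ p ∣
rank {p = inside ∷ p}  here       = zero
rank {p = inside ∷ p}  (there x∈) = suc (rank x∈)
rank {p = outside ∷ p} (there x∈) = rank x∈

nth-rank : ∀ {n} {p : Subset n} {x} (x∈ : x ∈ p) → nth p (rank x∈) ≡ x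
nth-rank {p = inside ∷ p}  here       = refl
nth-rank {p = inside ∷ p}  (there x∈) = cong suc (nth-rank x∈)
nth-rank {p = outside ∷ p} (there x∈) = cong suc (nth-rank x∈)

rank-injective : ∀ {x y} (x∈ : x ∈ p) (y∈ : y ∈ p) → rank x∈ ≡ rank y∈ → x ≡ y
rank-injective {p = p} x∈ y∈ eq = trans (sym (nth-rank x∈)) (trans (cong (nth p) eq) (nth-rank y∈))

injection⇒∣p∣≤m : ∀ {m} (f : ∀ {x} → x ∈ p → Fin m) →
  (∀ {x y} (x∈ : x ∈ p) (y∈ : y ∈ p) → f x∈ ≡ f y∈ → x ≡ y) → ∣ p ∣ ≤ m
injection⇒∣p∣≤m {p = p} f f-inj =
  injective⇒≤ {f = λ i → f (nth∈ p i)} (λ eq → nth-injective p (f-inj _ _ eq))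

injection⇒m≤∣p∣ : ∀ {m} (f : Fin m → Fin n) → (∀ i → f i ∈ p) →
  (∀ {i j} → f i ≡ f j → i ≡ j) → m ≤ ∣ p ∣
injection⇒m≤∣p∣ f f∈ f-inj =
  injective⇒≤ {f = λ i → rank (f∈ i)} (λ eq → f-inj (rank-injective (f∈ _) (f∈ _) eq))

injection⇒∣p∣≤∣q∣ : (f : Fin n → Fin n) → (∀ {x} → x ∈ p → f x ∈ q) →
  (∀ {x y} → f x ≡ f y → x ≡ y) → ∣ p ∣ ≤ ∣ q ∣
injection⇒∣p∣≤∣q∣ f f∈ f-inj =
  injection⇒∣p∣≤m (λ x∈ → rank (f∈ x∈)) (λ x∈ y∈ eq → f-inj (rank-injective (f∈ x∈) (f∈ y∈) eq))

⊈⇒∃∉ : (p q : Subset n) → ¬ (p ⊆ q) → ∃[ x ] x ∈ p × x ∉ q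
⊈⇒∃∉ p q p⊈q with any? (λ x → (x ∈? p) ×-dec ¬? (x ∈? q))
... | yes found = found
... | no none = ⊥-elim (p⊈q p⊆q)
  where
  p⊆q : p ⊆ q
  p⊆q {x} x∈p with x ∈? q
  ... | yes x∈q = x∈q
  ... | no x∉q  = contradiction (x , x∈p , x∉q) none

∣p∣<∣q∣⇒∃∉ : (p q : Subset n) → ∣ p ∣ < ∣ q ∣ → ∃[ x ] x ∈ q × x ∉ p
∣p∣<∣q∣⇒∃∉ p q p<q = ⊈⇒∃∉ q p (λ q⊆p → contradiction p<q (ℕ.≤⇒≯ (p⊆q⇒∣p∣≤∣q∣ q⊆p)))

∣p∣<n⇒∃∉ : (p : Subset n) → ∣ p ∣ < n → ∃[ x ] x ∉ p
∣p∣<n⇒∃∉ {n} p p<n with ∣p∣<∣q∣⇒∃∉ p ⊤ (subst (∣ p ∣ <_) (sym (∣⊤∣≡n n)) p<n)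
... | x , _ , x∉p = x , x∉p

∣q∣≤∣p∣⇒q⊆p : p ⊆ q → ∣ q ∣ ≤ ∣ p ∣ → q ⊆ p
∣q∣≤∣p∣⇒q⊆p {p = p} p⊆q q≤p {x} x∈q with x ∈? p
... | yes x∈p = x∈p
... | no x∉p  = contradiction q≤p (ℕ.<⇒≱ (p⊂q⇒∣p∣<∣q∣ (p⊆q , x , x∈q , x∉p)))

Nonempty⇒1≤∣p∣ : Nonempty p → 1 ≤ ∣ p ∣
Nonempty⇒1≤∣p∣ (_ , x∈p) = ≤-trans (s≤s z≤n) (toℕ<n (rank x∈p))

1≤∣p∣⇒Nonempty : (p : Subset n) → 1 ≤ ∣ p ∣ → Nonempty p
1≤∣p∣⇒Nonempty p 1≤p = nth p (fromℕ< 1≤p) , nth∈ p _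

2≤∣p∣⇒∃≢ : (p : Subset n) → 2 ≤ ∣ p ∣ → ∀ x → ∃[ y ] y ∈ p × y ≢ x
2≤∣p∣⇒∃≢ p 2≤p x with ∣p∣<∣q∣⇒∃∉ ⁅ x ⁆ p (subst (_< ∣ p ∣) (sym (∣⁅x⁆∣≡1 x)) 2≤p)
... | y , y∈p , y∉x = y , y∈p , λ { refl → y∉x (x∈⁅x⁆ x) }

x∉p⇒∣p∪x∣≡1+∣p∣ : (p : Subset n) → ∀ {x} → x ∉ p → ∣ p ∪ ⁅ x ⁆ ∣ ≡ suc ∣ p ∣
x∉p⇒∣p∪x∣≡1+∣p∣ p {x} x∉p = ≤-antisym
  (≤-trans (∣p∪q∣≤∣p∣+∣q∣ p ⁅ x ⁆) (≤-reflexive (trans (cong (∣ p ∣ +_) (∣⁅x⁆∣≡1 x)) (ℕ.+-comm _ 1))))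
  (p⊂q⇒∣p∣<∣q∣ (p⊆p∪q ⁅ x ⁆ , x , q⊆p∪q p ⁅ x ⁆ (x∈⁅x⁆ x) , x∉p))

two-elements⇒2≤∣p∣ : ∀ {x y} → x ∈ p → y ∈ p → x ≢ y → 2 ≤ ∣ p ∣
two-elements⇒2≤∣p∣ {p = p} {x} {y} x∈ y∈ x≢y =
  subst (_≤ ∣ p ∣) (trans (x∉p⇒∣p∪x∣≡1+∣p∣ ⁅ x ⁆ (λ y∈x → x≢y (sym (x∈⁅y⁆⇒x≡y x y∈x)))) (cong suc (∣⁅x⁆∣≡1 x)))
    (p⊆q⇒∣p∣≤∣q∣ {p = ⁅ x ⁆ ∪ ⁅ y ⁆} λ z∈ →
      [ (λ z∈x → subst (_∈ p) (sym (x∈⁅y⁆⇒x≡y x z∈x)) x∈)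
      , (λ z∈y → subst (_∈ p) (sym (x∈⁅y⁆⇒x≡y y z∈y)) y∈) ]′ (x∈p∪q⁻ ⁅ x ⁆ ⁅ y ⁆ z∈))

minimiser : ∀ {ℓ} {P : Subset n → Set ℓ} → Decidable P → (f : Subset n → ℕ) → ∃ P →
  ∃[ X ] P X × (∀ Y → P Y → f X ≤ f Y)
minimiser {P = P} P? f (X₀ , PX₀) = search X₀ PX₀ (<-wellFounded (f X₀))
  where
  search : ∀ X → P X → Acc _<_ (f X) → ∃[ X ] P X × (∀ Y → P Y → f X ≤ f Y)
  search X PX (acc rec) with anySubset? (λ Y → P? Y ×-dec (f Y <? f X))
  ... | yes (Y , PY , smaller) = search Y PY (rec smaller)
  ... | no none = X , PX , λ Y PY → ≮⇒≥ (λ smaller → none (Y , PY , smaller))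

-- Products and translates in a finite group.

module FiniteGroupTheory {c ℓ} (G : FiniteGroup c ℓ) where

  module 𝔾 = FiniteGroupSubsets G
  module GG = Group (FiniteGroup.group G)
  module Enum = Inverse (FiniteGroup.enumeration G)
  open 𝔾 public using
    ( order; index; element; GSubset; ｛_｝; powers
    ; IsSubgroup; IsNontrivial; IsProper; IsGeometricProgression)

  infixl 7 _∙_
  infix  9 _⁻¹

  element-index : ∀ x → element (index x) GG.≈ x
  element-index = Enum.strictlyInverseʳ

  index-element : ∀ i → index (element i) ≡ i
  index-element = Enum.strictlyInverseˡ

  -- The group law carried over to indices. It is opaque, so that only the group
  -- axioms are used, and never the enumeration.
  opaque
    _∙_ : Fin order → Fin order → Fin order
    i ∙ j = index (element i 𝔾.∙ element j)

    ε : Fin order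
    ε = index 𝔾.ε

    _⁻¹ : Fin order → Fin order
    i ⁻¹ = index (element i 𝔾.⁻¹)

    index-∙ : ∀ x y → index (x 𝔾.∙ y) ≡ index x ∙ index y
    index-∙ x y = Enum.to-cong (GG.sym (GG.∙-cong (element-index x) (element-index y)))

    index-ε : index 𝔾.ε ≡ ε
    index-ε = refl

    index-⁻¹ : ∀ x → index (x 𝔾.⁻¹) ≡ index x ⁻¹
    index-⁻¹ x = Enum.to-cong (GG.sym (GG.⁻¹-cong (element-index x)))

    isGroup : IsGroup _≡_ _∙_ ε _⁻¹
    isGroup = record
      { isMonoid = record
        { isSemigroup = record
          { isMagma = record { isEquivalence = isEquivalence ; ∙-cong = cong₂ _∙_ }
          ; assoc = λ i j k → Enum.to-cong (GG.trans (GG.∙-congʳ (element-index _))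
              (GG.trans (GG.assoc _ _ _) (GG.∙-congˡ (GG.sym (element-index _)))))
          }
        ; identity =
            (λ i → trans (Enum.to-cong (GG.trans (GG.∙-congʳ (element-index _)) (GG.identityˡ _))) (index-element i))
          , (λ i → trans (Enum.to-cong (GG.trans (GG.∙-congˡ (element-index _)) (GG.identityʳ _))) (index-element i))
        }
      ; inverse =
          (λ i → Enum.to-cong (GG.trans (GG.∙-congʳ (element-index _)) (GG.inverseˡ _)))
        , (λ i → Enum.to-cong (GG.trans (GG.∙-congˡ (element-index _)) (GG.inverseʳ _)))
      ; ⁻¹-cong = cong _⁻¹
      }

  indexGroup : Group 0ℓ 0ℓ
  indexGroup = record { isGroup = isGroup }

  open Group indexGroup public using (assoc; identityˡ; identityʳ; inverseˡ; inverseʳ)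
  open GroupProperties indexGroup public
    using (∙-cancelˡ; ∙-cancelʳ; ⁻¹-involutive; ⁻¹-injective; ⁻¹-anti-homo-∙
          ; \\-leftDividesˡ; \\-leftDividesʳ; //-rightDividesˡ; //-rightDividesʳ; inverseʳ-unique)

  infixl 7 _·_

  opaque
    unfolding _∙_

    -- Products and inverses of subsets, opaque like the group law: they are known
    -- through their elements only.
    _·_ : GSubset → GSubset → GSubset
    _·_ = 𝔾._·_

    ·≡𝔾· : ∀ X Y → X · Y ≡ X 𝔾.· Y
    ·≡𝔾· X Y = refl

    ∈-·⁺ : ∀ {X Y i j} → i ∈ X → j ∈ Y → i ∙ j ∈ X · Y
    ∈-·⁺ {X} {Y} i∈X j∈Y = ∈-comprehension⁺
      (λ k → any? λ i → any? λ j → (i ∈? X) ×-dec (j ∈? Y) ×-dec (k ≟ i ∙ j)) (_ , _ , i∈X , j∈Y , refl)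

    ∈-·⁻ : ∀ {X Y k} → k ∈ X · Y → ∃₂ λ i j → i ∈ X × j ∈ Y × k ≡ i ∙ j
    ∈-·⁻ {X} {Y} = ∈-comprehension⁻
      (λ k → any? λ i → any? λ j → (i ∈? X) ×-dec (j ∈? Y) ×-dec (k ≟ i ∙ j))

    inverses : GSubset → GSubset
    inverses = 𝔾.inverses

    inverses≡𝔾inverses : ∀ X → inverses X ≡ 𝔾.inverses X
    inverses≡𝔾inverses X = refl

    ∈-inverses⁺ : ∀ {X i} → i ∈ X → i ⁻¹ ∈ inverses X
    ∈-inverses⁺ {X} i∈X =
      ∈-comprehension⁺ (λ k → any? λ i → (i ∈? X) ×-dec (k ≟ i ⁻¹)) (_ , i∈X , refl)

    ∈-inverses⁻ : ∀ {X i} → i ∈ inverses X → i ⁻¹ ∈ X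
    ∈-inverses⁻ {X} i∈ with ∈-comprehension⁻ (λ k → any? λ i → (i ∈? X) ×-dec (k ≟ i ⁻¹)) i∈
    ... | j , j∈X , refl = subst (_∈ X) (sym (⁻¹-involutive j)) j∈X

  ·-monoˡ : ∀ {X Y} S → X ⊆ Y → X · S ⊆ Y · S
  ·-monoˡ S X⊆Y k∈ with ∈-·⁻ k∈
  ... | i , j , i∈X , j∈S , refl = ∈-·⁺ (X⊆Y i∈X) j∈S

  ∣inverses∣ : ∀ X → ∣ inverses X ∣ ≡ ∣ X ∣
  ∣inverses∣ X = ≤-antisym
    (injection⇒∣p∣≤∣q∣ _⁻¹ ∈-inverses⁻ ⁻¹-injective)
    (injection⇒∣p∣≤∣q∣ _⁻¹ ∈-inverses⁺ ⁻¹-injective)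

  ∣X∣≤∣X·S∣ : ∀ {X S} → Nonempty S → ∣ X ∣ ≤ ∣ X · S ∣
  ∣X∣≤∣X·S∣ (s , s∈S) = injection⇒∣p∣≤∣q∣ (_∙ s) (λ x∈ → ∈-·⁺ x∈ s∈S) (∙-cancelʳ s _ _)

  ∣S∣≤∣X·S∣ : ∀ {X S} → Nonempty X → ∣ S ∣ ≤ ∣ X · S ∣
  ∣S∣≤∣X·S∣ (x , x∈X) = injection⇒∣p∣≤∣q∣ (x ∙_) (λ s∈ → ∈-·⁺ x∈X s∈) (∙-cancelˡ x _ _)

  ∣X·Y∣≡∣X∣*∣Y∣ : ∀ X Y →
    (∀ {i i′ j j′} → i ∈ X → i′ ∈ X → j ∈ Y → j′ ∈ Y → i ∙ j ≡ i′ ∙ j′ → i ≡ i′ × j ≡ j′) →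
    ∣ X · Y ∣ ≡ ∣ X ∣ * ∣ Y ∣
  ∣X·Y∣≡∣X∣*∣Y∣ X Y unique = ≤-antisym
    (injection⇒∣p∣≤m pair pair-injective) (injection⇒m≤∣p∣ multiply multiply∈ multiply-injective)
    where
    pair : ∀ {z} → z ∈ X · Y → Fin (∣ X ∣ * ∣ Y ∣)
    pair z∈ with ∈-·⁻ {X} {Y} z∈
    ... | i , j , i∈X , j∈Y , _ = combine (rank i∈X) (rank j∈Y)

    pair-injective : ∀ {z z′} (z∈ : z ∈ X · Y) (z′∈ : z′ ∈ X · Y) → pair z∈ ≡ pair z′∈ → z ≡ z′
    pair-injective z∈ z′∈ eq with ∈-·⁻ {X} {Y} z∈ | ∈-·⁻ {X} {Y} z′∈
    ... | i , j , i∈X , j∈Y , refl | i′ , j′ , i′∈X , j′∈Y , refl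
      with combine-injective (rank i∈X) (rank j∈Y) (rank i′∈X) (rank j′∈Y) eq
    ... | eqˡ , eqʳ = cong₂ _∙_ (rank-injective i∈X i′∈X eqˡ) (rank-injective j∈Y j′∈Y eqʳ)

    quot : Fin (∣ X ∣ * ∣ Y ∣) → Fin ∣ X ∣
    quot k = proj₁ (remQuot {∣ X ∣} ∣ Y ∣ k)

    rem : Fin (∣ X ∣ * ∣ Y ∣) → Fin ∣ Y ∣
    rem k = proj₂ (remQuot {∣ X ∣} ∣ Y ∣ k)

    multiply : Fin (∣ X ∣ * ∣ Y ∣) → Fin order
    multiply k = nth X (quot k) ∙ nth Y (rem k)

    multiply∈ : ∀ k → multiply k ∈ X · Y
    multiply∈ k = ∈-·⁺ (nth∈ X _) (nth∈ Y _)

    multiply-injective : ∀ {k k′} → multiply k ≡ multiply k′ → k ≡ k′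
    multiply-injective {k} {k′} eq with unique (nth∈ X _) (nth∈ X _) (nth∈ Y _) (nth∈ Y _) eq
    ... | eqˡ , eqʳ = trans (sym (combine-remQuot {∣ X ∣} ∣ Y ∣ k))
      (trans (cong₂ combine (nth-injective X eqˡ) (nth-injective Y eqʳ)) (combine-remQuot {∣ X ∣} ∣ Y ∣ k′))

  infixr 8 _◃_

  opaque
    -- The left translate gX.
    _◃_ : Fin order → GSubset → GSubset
    g ◃ X = comprehension λ x → (g ⁻¹ ∙ x) ∈? X

    ∈-◃⁺ : ∀ {g X x} → g ⁻¹ ∙ x ∈ X → x ∈ g ◃ X
    ∈-◃⁺ {g} {X} = ∈-comprehension⁺ (λ x → (g ⁻¹ ∙ x) ∈? X)

    ∈-◃⁻ : ∀ {g X x} → x ∈ g ◃ X → g ⁻¹ ∙ x ∈ X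
    ∈-◃⁻ {g} {X} = ∈-comprehension⁻ (λ x → (g ⁻¹ ∙ x) ∈? X)

  ∙∈◃ : ∀ {g X x} → x ∈ X → g ∙ x ∈ g ◃ X
  ∙∈◃ {g} {X} {x} x∈X = ∈-◃⁺ (subst (_∈ X) (sym (\\-leftDividesʳ g x)) x∈X)

  ∙∈◃⁻ : ∀ {g X x} → g ∙ x ∈ g ◃ X → x ∈ X
  ∙∈◃⁻ {g} {X} {x} gx∈ = subst (_∈ X) (\\-leftDividesʳ g x) (∈-◃⁻ gx∈)

  ◃-∙ : ∀ {g h X x} → x ∈ h ◃ X → g ∙ x ∈ (g ∙ h) ◃ X
  ◃-∙ {g} {h} {X} {x} x∈ = ∈-◃⁺ (subst (_∈ X) eq (∈-◃⁻ x∈))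
    where
    open ≡-Reasoning
    eq : h ⁻¹ ∙ x ≡ (g ∙ h) ⁻¹ ∙ (g ∙ x)
    eq = begin
      h ⁻¹ ∙ x                  ≡⟨ cong (h ⁻¹ ∙_) (\\-leftDividesʳ g x) ⟨
      h ⁻¹ ∙ (g ⁻¹ ∙ (g ∙ x))   ≡⟨ assoc _ _ _ ⟨
      h ⁻¹ ∙ g ⁻¹ ∙ (g ∙ x)     ≡⟨ cong (_∙ (g ∙ x)) (⁻¹-anti-homo-∙ g h) ⟨
      (g ∙ h) ⁻¹ ∙ (g ∙ x)      ∎

  ∣g◃X∣≡∣X∣ : ∀ g X → ∣ g ◃ X ∣ ≡ ∣ X ∣
  ∣g◃X∣≡∣X∣ g X = ≤-antisym
    (injection⇒∣p∣≤∣q∣ (g ⁻¹ ∙_) ∈-◃⁻ (∙-cancelˡ (g ⁻¹) _ _))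
    (injection⇒∣p∣≤∣q∣ (g ∙_) ∙∈◃ (∙-cancelˡ g _ _))

  ∣g◃X·S∣≤∣X·S∣ : ∀ g X S → ∣ g ◃ X · S ∣ ≤ ∣ X · S ∣
  ∣g◃X·S∣≤∣X·S∣ g X S = injection⇒∣p∣≤∣q∣ (g ⁻¹ ∙_) back (∙-cancelˡ (g ⁻¹) _ _)
    where
    back : ∀ {k} → k ∈ g ◃ X · S → g ⁻¹ ∙ k ∈ X · S
    back k∈ with ∈-·⁻ k∈
    ... | i , j , i∈ , j∈S , refl = subst (_∈ X · S) (assoc _ _ _) (∈-·⁺ (∈-◃⁻ i∈) j∈S)

  -- Left translation by an element of H is injective, so it permutes H and reaches ε.
  closed⇒subgroup : ∀ {H} → ε ∈ H → (∀ {x y} → x ∈ H → y ∈ H → x ∙ y ∈ H) → IsSubgroup H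
  closed⇒subgroup {H} ε∈H closed = record
    { ε∈        = subst (_∈ H) (sym index-ε) ε∈H
    ; ∙-closed  = λ x y x∈ y∈ → subst (_∈ H) (sym (index-∙ x y)) (closed x∈ y∈)
    ; ⁻¹-closed = λ x x∈ → subst (_∈ H) (sym (index-⁻¹ x)) (inverse∈ x∈)
    }
    where
    inverse∈ : ∀ {x} → x ∈ H → x ⁻¹ ∈ H
    inverse∈ {x} x∈ = subst (_∈ H) (identityʳ (x ⁻¹))
      (∈-◃⁻ (∣q∣≤∣p∣⇒q⊆p xH⊆H (≤-reflexive (sym (∣g◃X∣≡∣X∣ x H))) ε∈H))
      where
      xH⊆H : x ◃ H ⊆ H
      xH⊆H {y} y∈ = subst (_∈ H) (\\-leftDividesˡ x y) (closed x∈ (∈-◃⁻ y∈))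

  module _ {H} (subgroup : IsSubgroup H) where
    open IsSubgroup subgroup

    subgroup-ε : ε ∈ H
    subgroup-ε = subst (_∈ H) index-ε ε∈

    subgroup-∙ : ∀ {i j} → i ∈ H → j ∈ H → i ∙ j ∈ H
    subgroup-∙ {i} {j} i∈ j∈ = subst (_∈ H) (trans (index-∙ _ _) (cong₂ _∙_ (index-element i) (index-element j)))
      (∙-closed (element i) (element j) (subst (_∈ H) (sym (index-element i)) i∈) (subst (_∈ H) (sym (index-element j)) j∈))

    subgroup-⁻¹ : ∀ {i} → i ∈ H → i ⁻¹ ∈ H
    subgroup-⁻¹ {i} i∈ = subst (_∈ H) (trans (index-⁻¹ _) (cong _⁻¹ (index-element i)))
      (⁻¹-closed (element i) (subst (_∈ H) (sym (index-element i)) i∈))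

  2≤∣H∣⇒nontrivial : ∀ {H} → 2 ≤ ∣ H ∣ → IsNontrivial H
  2≤∣H∣⇒nontrivial 2≤H refl with subst (2 ≤_) (∣⁅x⁆∣≡1 (index 𝔾.ε)) 2≤H
  ... | s≤s ()

  ∣H∣<order⇒proper : ∀ {H} → ∣ H ∣ < order → IsProper H
  ∣H∣<order⇒proper H<n refl = ℕ.<⇒≢ H<n (∣⊤∣≡n order)

  opaque
    -- The elements g with gA contained in X.
    transporter : GSubset → GSubset → GSubset
    transporter A X = comprehension λ g → (g ◃ A) ⊆? X

    ∈-transporter⁺ : ∀ {A X g} → g ◃ A ⊆ X → g ∈ transporter A X
    ∈-transporter⁺ {A} {X} gA⊆X = ∈-comprehension⁺ (λ g → (g ◃ A) ⊆? X) (λ {x} → gA⊆X {x})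

    ∈-transporter⁻ : ∀ {A X g} → g ∈ transporter A X → g ◃ A ⊆ X
    ∈-transporter⁻ {A} {X} g∈ = ∈-comprehension⁻ (λ g → (g ◃ A) ⊆? X) g∈

  -- The elements g with gX contained in X; then gX is all of X, by finiteness.
  stabiliser : GSubset → GSubset
  stabiliser X = transporter X X

  stabiliser-∙ : ∀ {X g x} → g ∈ stabiliser X → x ∈ X → g ∙ x ∈ X
  stabiliser-∙ g∈ x∈X = ∈-transporter⁻ g∈ (∙∈◃ x∈X)

  ∈-stabiliser⁺ : ∀ {X g} → (∀ {x} → x ∈ X → g ∙ x ∈ X) → g ∈ stabiliser X
  ∈-stabiliser⁺ {X} {g} stable = ∈-transporter⁺ λ {x} x∈ →
    subst (_∈ X) (\\-leftDividesˡ g x) (stable (∈-◃⁻ x∈))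

  stabiliser-subgroup : ∀ X → IsSubgroup (stabiliser X)
  stabiliser-subgroup X = closed⇒subgroup
    (∈-stabiliser⁺ λ {x} x∈ → subst (_∈ X) (sym (identityˡ x)) x∈)
    (λ {g} {h} g∈ h∈ → ∈-stabiliser⁺ λ {x} x∈ →
      subst (_∈ X) (sym (assoc g h x)) (stabiliser-∙ g∈ (stabiliser-∙ h∈ x∈)))

  stabiliser-proper : ∀ {X} → Nonempty X → ∣ X ∣ < order → ∣ stabiliser X ∣ < order
  stabiliser-proper {X} (x , x∈X) X<n = ≤-trans (s≤s
    (injection⇒∣p∣≤∣q∣ (_∙ x) (λ g∈ → stabiliser-∙ g∈ x∈X) (∙-cancelʳ x _ _))) X<n

  -- Powers of an index.
  _^_ : Fin order → ℕ → Fin order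
  b ^ zero  = ε
  b ^ suc k = b ∙ b ^ k

  infixr 9 _^_

  index-^ : ∀ b k → index (element b 𝔾.^ k) ≡ b ^ k
  index-^ b zero    = index-ε
  index-^ b (suc k) = trans (index-∙ _ _) (cong₂ _∙_ (index-element b) (index-^ b k))

  ^-+ : ∀ b k l → b ^ (k + l) ≡ b ^ k ∙ b ^ l
  ^-+ b zero    l = sym (identityˡ _)
  ^-+ b (suc k) l = trans (cong (b ∙_) (^-+ b k l)) (sym (assoc _ _ _))

  ^-suc : ∀ b k → b ^ suc k ≡ b ^ k ∙ b
  ^-suc b k = trans (cong (b ^_) (ℕ.+-comm 1 k)) (trans (^-+ b k 1) (cong (b ^ k ∙_) (identityʳ b)))

  ⁻¹-^ : ∀ b k → (b ^ k) ⁻¹ ≡ (b ⁻¹) ^ k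
  ⁻¹-^ b zero    = sym (inverseʳ-unique ε ε (identityˡ ε))
  ⁻¹-^ b (suc k) = trans (cong _⁻¹ (^-suc b k)) (trans (⁻¹-anti-homo-∙ _ _) (cong (b ⁻¹ ∙_) (⁻¹-^ b k)))

  -- Almost periodic sets.

  ∈-·⁅⁆⁻ : ∀ {X x z} → z ∈ X · ⁅ x ⁆ → z ∙ x ⁻¹ ∈ X
  ∈-·⁅⁆⁻ {X} {x} z∈ with ∈-·⁻ z∈
  ... | i , j , i∈X , j∈x , refl rewrite x∈⁅y⁆⇒x≡y x j∈x = subst (_∈ X) (sym (//-rightDividesʳ x i)) i∈X

  ∣X·⁅x⁆∣≡∣X∣ : ∀ X x → ∣ X · ⁅ x ⁆ ∣ ≡ ∣ X ∣
  ∣X·⁅x⁆∣≡∣X∣ X x = ≤-antisym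
    (injection⇒∣p∣≤∣q∣ (_∙ x ⁻¹) ∈-·⁅⁆⁻ (∙-cancelʳ (x ⁻¹) _ _))
    (∣X∣≤∣X·S∣ (x , x∈⁅x⁆ x))

  subgroup-^ : ∀ {H} → IsSubgroup H → ∀ {b} → b ∈ H → ∀ k → b ^ k ∈ H
  subgroup-^ H≤G b∈ zero    = subgroup-ε H≤G
  subgroup-^ H≤G b∈ (suc k) = subgroup-∙ H≤G b∈ (subgroup-^ H≤G b∈ k)

  -- S is a translate {p, bp, b²p, …} of a geometric progression with |S| terms.
  Progression : GSubset → Set
  Progression S = ∃₂ λ b p →
    (∀ {x} → x ∈ S → ∃ λ i → i < ∣ S ∣ × x ≡ b ^ i ∙ p) × (∀ {i} → i < ∣ S ∣ → b ^ i ∙ p ∈ S)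

  -- S is nearly a union of cosets of H, in that |HS| < |H| + |S|, for some
  -- non-trivial proper subgroup H.
  NearlyPeriodic : GSubset → Set c
  NearlyPeriodic S = ∃[ H ] IsSubgroup H × IsNontrivial H × IsProper H
    × ∣ H · S ∣ ≤ ∣ H ∣ + ∣ S ∣ ∸ 1

  -- S is extremal for A = H ∪ Hx, where HxH has the greatest possible size |H|².
  Exceptional : GSubset → Set c
  Exceptional S = ∃[ H ] ∃[ x ] IsSubgroup H × ∣ H · ⁅ x ⁆ · H ∣ ≡ ∣ H ∣ * ∣ H ∣
    × (let A = H ∪ H · ⁅ x ⁆ in
       ∣ A · S ∣ ≡ ∣ A ∣ + ∣ S ∣ ∸ 1 × ∣ A ∣ + ∣ S ∣ ∸ 1 ≡ order ∸ ∣ A ∣)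

  powers-characterisation : ∀ {Z b m} → (∀ {z} → z ∈ Z → ∃ λ i → i < m × z ≡ b ^ i) →
    (∀ {i} → i < m → b ^ i ∈ Z) → Z ≡ powers (element b) m
  powers-characterisation {Z} {b} {m} expand power∈ = ⊆-antisym to from
    where
    isPower? : ∀ k → Dec (∃ λ (i : Fin m) → k ≡ index (element b 𝔾.^ toℕ i))
    isPower? k = any? λ i → k ≟ index (element b 𝔾.^ toℕ i)

    to : Z ⊆ powers (element b) m
    to {z} z∈ with expand z∈
    ... | i , i<m , refl = ∈-comprehension⁺ isPower?
      (fromℕ< i<m , sym (trans (index-^ b (toℕ (fromℕ< i<m))) (cong (b ^_) (toℕ-fromℕ< i<m))))

    from : powers (element b) m ⊆ Z
    from {z} z∈ with ∈-comprehension⁻ isPower? z∈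
    ... | i , refl = subst (_∈ Z) (sym (index-^ b (toℕ i))) (power∈ (toℕ<n i))

  progression⇒geometric : ∀ {S} → Progression S → IsGeometricProgression S
  progression⇒geometric {S} (b , p , expand , term∈) =
    element (p ⁻¹) , element b , inj₂ (trans (sym (·≡𝔾· S _)) (powers-characterisation
      (λ z∈ → let i , i<m , eq = expand (shifted z∈) in i , i<m , ∙-cancelʳ p _ _ eq)
      (λ {i} i<m → subst (_∈ S · ｛ element (p ⁻¹) ｝) (//-rightDividesʳ p (b ^ i))
        (∈-·⁺ (term∈ i<m) (subst (_∈ ｛ element (p ⁻¹) ｝) (index-element (p ⁻¹)) (x∈⁅x⁆ _))))))
    where
    shifted : ∀ {z} → z ∈ S · ｛ element (p ⁻¹) ｝ → z ∙ p ∈ S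
    shifted {z} z∈ = subst (λ y → z ∙ y ∈ S)
      (trans (cong _⁻¹ (index-element (p ⁻¹))) (⁻¹-involutive p)) (∈-·⁅⁆⁻ z∈)

  -- The inverse of bⁱp is p⁻¹(b⁻¹)ⁱ, so left translation by p makes
  -- S = (S⁻¹)⁻¹ the set of powers of b⁻¹.
  progression-inverses⇒geometric : ∀ {S} → Progression (inverses S) → IsGeometricProgression S
  progression-inverses⇒geometric {S} (b , p , expand , term∈) =
    element p , element (b ⁻¹) , inj₁ (trans (sym (·≡𝔾· _ S)) (powers-characterisation to from))
    where
    open ≡-Reasoning

    to : ∀ {z} → z ∈ ｛ element p ｝ · S → ∃ λ i → i < ∣ S ∣ × z ≡ (b ⁻¹) ^ i
    to z∈ with ∈-·⁻ z∈
    ... | j , s , j∈ , s∈S , refl with expand (∈-inverses⁺ s∈S)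
    ... | i , i<m , eq = i , subst (i <_) (∣inverses∣ S) i<m , (begin
      j ∙ s                          ≡⟨ cong₂ _∙_ (trans (x∈⁅y⁆⇒x≡y _ j∈) (index-element p)) (sym (⁻¹-involutive s)) ⟩
      p ∙ (s ⁻¹) ⁻¹                  ≡⟨ cong (λ y → p ∙ y ⁻¹) eq ⟩
      p ∙ (b ^ i ∙ p) ⁻¹             ≡⟨ cong (p ∙_) (⁻¹-anti-homo-∙ (b ^ i) p) ⟩
      p ∙ (p ⁻¹ ∙ (b ^ i) ⁻¹)        ≡⟨ \\-leftDividesˡ p _ ⟩
      (b ^ i) ⁻¹                     ≡⟨ ⁻¹-^ b i ⟩
      (b ⁻¹) ^ i                     ∎)

    from : ∀ {i} → i < ∣ S ∣ → (b ⁻¹) ^ i ∈ ｛ element p ｝ · S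
    from {i} i<m = subst (_∈ ｛ element p ｝ · S) eq
      (∈-·⁺ (subst (_∈ ｛ element p ｝) (index-element p) (x∈⁅x⁆ _))
        (∈-inverses⁻ (term∈ (subst (i <_) (sym (∣inverses∣ S)) i<m))))
      where
      eq : p ∙ (b ^ i ∙ p) ⁻¹ ≡ (b ⁻¹) ^ i
      eq = begin
        p ∙ (b ^ i ∙ p) ⁻¹         ≡⟨ cong (p ∙_) (⁻¹-anti-homo-∙ (b ^ i) p) ⟩
        p ∙ (p ⁻¹ ∙ (b ^ i) ⁻¹)    ≡⟨ \\-leftDividesˡ p _ ⟩
        (b ^ i) ⁻¹                 ≡⟨ ⁻¹-^ b i ⟩
        (b ⁻¹) ^ i                 ∎

  stabiliser⇒nearlyPeriodic : ∀ {S R α} → Nonempty R → ∣ R ∣ < order → α ≢ ε → α ∈ stabiliser R →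
    ∣ stabiliser R · S ∣ < ∣ stabiliser R ∣ + ∣ S ∣ → NearlyPeriodic S
  stabiliser⇒nearlyPeriodic {S} {R} R≠∅ R<n α≢ε α∈ small =
    stabiliser R , H≤G , 2≤∣H∣⇒nontrivial (two-elements⇒2≤∣p∣ α∈ (subgroup-ε H≤G) α≢ε) ,
    ∣H∣<order⇒proper (stabiliser-proper R≠∅ R<n) , ℕ.∸-monoˡ-≤ 1 small
    where
    H≤G : IsSubgroup (stabiliser R)
    H≤G = stabiliser-subgroup R

  -- Two equal powers bⁱ = bʲ with i < j give d = j - i - 1.
  inverse-is-power : ∀ b → ∃ λ d → b ^ d ≡ b ⁻¹
  inverse-is-power b with pigeonhole ≤-refl (λ (i : Fin (suc order)) → b ^ toℕ i)
  ... | i , j , i<j , eq with ℕ.m≤n⇒∃[o]m+o≡n i<j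
  ... | d , refl′ = d , inverseʳ-unique b (b ^ d) (∙-cancelˡ (b ^ toℕ i) _ _ (begin
      b ^ toℕ i ∙ b ^ suc d    ≡⟨ ^-+ b (toℕ i) (suc d) ⟨
      b ^ (toℕ i + suc d)      ≡⟨ cong (b ^_) (trans (ℕ.+-suc (toℕ i) d) refl′) ⟩
      b ^ toℕ j                ≡⟨ eq ⟨
      b ^ toℕ i                ≡⟨ identityʳ _ ⟨
      b ^ toℕ i ∙ ε            ∎))
    where open ≡-Reasoning

  -- The structure of a set S to which translation by α adds at most one element.
  module AlmostPeriodic {S α} (S≠∅ : Nonempty S) (S<n : ∣ S ∣ < order) (α≢ε : α ≢ ε)
    (small : ∣ S ∪ α ◃ S ∣ ≤ suc ∣ S ∣) where

    periodic : α ◃ S ⊆ S → NearlyPeriodic S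
    periodic αS⊆S = stabiliser⇒nearlyPeriodic S≠∅ S<n α≢ε (∈-transporter⁺ αS⊆S)
      (≤-trans (s≤s (p⊆q⇒∣p∣≤∣q∣ HS⊆S)) (ℕ.+-monoˡ-≤ ∣ S ∣ (Nonempty⇒1≤∣p∣ (ε , subgroup-ε (stabiliser-subgroup S)))))
      where
      HS⊆S : stabiliser S · S ⊆ S
      HS⊆S z∈ with ∈-·⁻ z∈
      ... | g , s , g∈ , s∈ , refl = stabiliser-∙ g∈ s∈

    -- Here p is the one element of S that multiplication by α expels from S.
    module _ {p} (p∈S : p ∈ S) (αp∉S : α ∙ p ∉ S) where

      expelled-unique : ∀ {x} → x ∈ S → x ≢ p → α ∙ x ∈ S
      expelled-unique {x} x∈S x≢p with (α ∙ x) ∈? S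
      ... | yes αx∈S = αx∈S
      ... | no αx∉S = contradiction small (ℕ.<⇒≱ (begin-strict
        suc ∣ S ∣                                ≡⟨ x∉p⇒∣p∪x∣≡1+∣p∣ S αp∉S ⟨
        ∣ S ∪ ⁅ α ∙ p ⁆ ∣                        <⟨ ≤-refl ⟩
        suc ∣ S ∪ ⁅ α ∙ p ⁆ ∣                    ≡⟨ x∉p⇒∣p∪x∣≡1+∣p∣ (S ∪ ⁅ α ∙ p ⁆) αx∉ ⟨
        ∣ (S ∪ ⁅ α ∙ p ⁆) ∪ ⁅ α ∙ x ⁆ ∣          ≤⟨ p⊆q⇒∣p∣≤∣q∣ inside-union ⟩
        ∣ S ∪ α ◃ S ∣                            ∎))
        where
        open ℕ.≤-Reasoning
        αx∉ : α ∙ x ∉ S ∪ ⁅ α ∙ p ⁆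
        αx∉ αx∈ = [ αx∉S , (λ αx∈p → x≢p (∙-cancelˡ α _ _ (x∈⁅y⁆⇒x≡y _ αx∈p))) ]′ (x∈p∪q⁻ S _ αx∈)

        translated : ∀ {y z} → y ∈ S → z ∈ ⁅ α ∙ y ⁆ → z ∈ S ∪ α ◃ S
        translated y∈S z∈ = subst (_∈ S ∪ α ◃ S) (sym (x∈⁅y⁆⇒x≡y _ z∈)) (q⊆p∪q S (α ◃ S) (∙∈◃ y∈S))

        inside-union : (S ∪ ⁅ α ∙ p ⁆) ∪ ⁅ α ∙ x ⁆ ⊆ S ∪ α ◃ S
        inside-union z∈ with x∈p∪q⁻ (S ∪ ⁅ α ∙ p ⁆) _ z∈
        ... | inj₂ z∈x = translated x∈S z∈x
        ... | inj₁ z∈′ with x∈p∪q⁻ S _ z∈′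
        ... | inj₁ z∈S = p⊆p∪q (α ◃ S) z∈S
        ... | inj₂ z∈p = translated p∈S z∈p

      b : Fin order
      b = α ⁻¹

      -- The sequence p, α⁻¹p, α⁻²p, … leaves S, as it reaches αp.
      term : ℕ → Fin order
      term i = b ^ i ∙ p

      initial-segment : ∀ k → (∀ {i} → i < k → term i ∈ S)
        ⊎ (∃ λ m → term m ∉ S × (∀ {i} → i < m → term i ∈ S))
      initial-segment zero = inj₁ λ ()
      initial-segment (suc k) with initial-segment k
      ... | inj₂ found = inj₂ found
      ... | inj₁ below with term k ∈? S
      ... | no k∉  = inj₂ (k , k∉ , below)
      ... | yes k∈ = inj₁ λ { (s≤s i≤k) → [ below , (λ { refl → k∈ }) ]′ (ℕ.m≤n⇒m<n∨m≡n i≤k) }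

      abstract
        first-exit : ∃ λ m → term m ∉ S × (∀ {i} → i < m → term i ∈ S)
        first-exit with inverse-is-power b
        ... | d , bᵈ≡b⁻¹ with initial-segment (suc d)
        ... | inj₂ found = found
        ... | inj₁ below = contradiction
          (subst (_∈ S) (cong (_∙ p) (trans bᵈ≡b⁻¹ (⁻¹-involutive α))) (below ≤-refl)) αp∉S

      m : ℕ
      m = proj₁ first-exit

      exit : term m ∉ S
      exit = proj₁ (proj₂ first-exit)

      terms∈S : ∀ {i} → i < m → term i ∈ S
      terms∈S = proj₂ (proj₂ first-exit)

      term-0 : term 0 ≡ p
      term-0 = identityˡ p

      0<m : 0 < m
      0<m = ℕ.n≢0⇒n>0 λ m≡0 → exit (subst (_∈ S) (trans (sym term-0) (cong term (sym m≡0))) p∈S)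

      -- A repetition within the segment would make the exit term an earlier one.
      terms-distinct : ∀ {i j} → i < j → j < m → term i ≢ term j
      terms-distinct {i} {j} i<j j<m eq with ℕ.m≤n⇒∃[o]m+o≡n i<j
      ... | d , refl with ℕ.m≤n⇒∃[o]m+o≡n (≤-trans (s≤s (ℕ.m≤n+m d i)) (ℕ.<⇒≤ j<m))
      ... | r , eq′ = exit (subst (_∈ S) (cong (_∙ p) (sym bᵐ≡bʳ)) (terms∈S r<m))
        where
        open ≡-Reasoning
        r<m : r < m
        r<m = subst (r <_) eq′ (s≤s (ℕ.m≤n+m r d))

        b^1+d≡ε : b ^ suc d ≡ ε
        b^1+d≡ε = ∙-cancelˡ (b ^ i) _ _ (begin
          b ^ i ∙ b ^ suc d    ≡⟨ ^-+ b i (suc d) ⟨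
          b ^ (i + suc d)      ≡⟨ cong (b ^_) (ℕ.+-suc i d) ⟩
          b ^ suc (i + d)      ≡⟨ ∙-cancelʳ p _ _ eq ⟨
          b ^ i                ≡⟨ identityʳ _ ⟨
          b ^ i ∙ ε            ∎)

        bᵐ≡bʳ : b ^ m ≡ b ^ r
        bᵐ≡bʳ = begin
          b ^ m                ≡⟨ cong (b ^_) eq′ ⟨
          b ^ (suc d + r)      ≡⟨ ^-+ b (suc d) r ⟩
          b ^ suc d ∙ b ^ r    ≡⟨ cong (_∙ b ^ r) b^1+d≡ε ⟩
          ε ∙ b ^ r            ≡⟨ identityˡ _ ⟩
          b ^ r                ∎

      terms-injective : ∀ {i j : Fin m} → term (toℕ i) ≡ term (toℕ j) → i ≡ j
      terms-injective {i} {j} eq with Fin.<-cmp i j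
      ... | tri< i<j _ _ = contradiction eq (terms-distinct i<j (toℕ<n j))
      ... | tri≈ _ i≡j _ = i≡j
      ... | tri> _ _ j<i = contradiction (sym eq) (terms-distinct j<i (toℕ<n i))

      isTerm? : ∀ x → Dec (∃ λ (i : Fin m) → x ≡ term (toℕ i))
      isTerm? x = any? λ i → x ≟ term (toℕ i)

      -- What is left of S once the segment from p to the exit is removed. Left
      -- multiplication by α maps it into itself: the element p with αp outside S has been
      -- removed, and α⁻¹ maps the segment into itself except for its last term, which it
      -- sends outside S.
      rest : GSubset
      rest = S ∩ ∁ (comprehension isTerm?)

      rest⁻ : ∀ {x} → x ∈ rest → x ∈ S × (∀ {i} → i < m → x ≢ term i)
      rest⁻ x∈ with x∈p∩q⁻ S _ x∈
      ... | x∈S , x∈∁ = x∈S , λ {i} i<m eq → x∈∁p⇒x∉p x∈∁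
        (∈-comprehension⁺ isTerm? (fromℕ< i<m , trans eq (cong term (sym (toℕ-fromℕ< i<m)))))

      rest-or-term : ∀ {x} → x ∈ S → x ∈ rest ⊎ (∃ λ (i : Fin m) → x ≡ term (toℕ i))
      rest-or-term {x} x∈S with isTerm? x
      ... | yes isTerm = inj₂ isTerm
      ... | no ¬isTerm = inj₁ (x∈p∩q⁺ (x∈S , x∉p⇒x∈∁p (¬isTerm ∘ ∈-comprehension⁻ isTerm?)))

      rest-stable : ∀ {x} → x ∈ rest → α ∙ x ∈ rest
      rest-stable {x} x∈ with rest⁻ x∈
      ... | x∈S , notTerm with rest-or-term (expelled-unique x∈S (λ x≡p → notTerm 0<m (trans x≡p (sym term-0))))
      ... | inj₁ αx∈ = αx∈
      ... | inj₂ (i , αx≡) = ⊥-elim ([ (λ 1+i<m → notTerm 1+i<m x≡)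
        , (λ 1+i≡m → exit (subst (_∈ S) (trans x≡ (cong term 1+i≡m)) x∈S)) ]′
        (ℕ.m≤n⇒m<n∨m≡n (toℕ<n i)))
        where
        x≡ : x ≡ term (suc (toℕ i))
        x≡ = begin
          x                            ≡⟨ \\-leftDividesʳ α x ⟨
          α ⁻¹ ∙ (α ∙ x)               ≡⟨ cong (α ⁻¹ ∙_) αx≡ ⟩
          α ⁻¹ ∙ term (toℕ i)          ≡⟨ assoc _ _ _ ⟨
          term (suc (toℕ i))           ∎
          where open ≡-Reasoning

      no-rest⇒progression : ¬ Nonempty rest → Progression S
      no-rest⇒progression none = b , p ,
        (λ x∈S → let i , eq = isTerm x∈S in toℕ i , subst (toℕ i <_) m≡∣S∣ (toℕ<n i) , eq) ,
        (λ {i} i< → terms∈S (subst (i <_) (sym m≡∣S∣) i<))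
        where
        isTerm : ∀ {x} → x ∈ S → ∃ λ (i : Fin m) → x ≡ term (toℕ i)
        isTerm {x} x∈S with rest-or-term x∈S
        ... | inj₁ x∈ = contradiction (x , x∈) none
        ... | inj₂ found = found

        m≡∣S∣ : m ≡ ∣ S ∣
        m≡∣S∣ = ≤-antisym
          (injection⇒m≤∣p∣ (term ∘ toℕ) (λ i → terms∈S (toℕ<n i)) terms-injective)
          (injection⇒∣p∣≤m (λ x∈ → proj₁ (isTerm x∈)) λ x∈ y∈ eq →
            trans (proj₂ (isTerm x∈)) (trans (cong (term ∘ toℕ) eq) (sym (proj₂ (isTerm y∈)))))

      rest⇒nearlyPeriodic : Nonempty rest → NearlyPeriodic S
      rest⇒nearlyPeriodic rest≠∅ =
        stabiliser⇒nearlyPeriodic rest≠∅ (ℕ.<-trans rest<S S<n) α≢ε α∈H (begin-strict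
          ∣ H · S ∣                      ≤⟨ p⊆q⇒∣p∣≤∣q∣ HS⊆ ⟩
          ∣ H · ⁅ p ⁆ ∪ rest ∣           ≤⟨ ∣p∪q∣≤∣p∣+∣q∣ (H · ⁅ p ⁆) rest ⟩
          ∣ H · ⁅ p ⁆ ∣ + ∣ rest ∣       ≡⟨ cong (_+ ∣ rest ∣) (∣X·⁅x⁆∣≡∣X∣ H p) ⟩
          ∣ H ∣ + ∣ rest ∣               <⟨ ℕ.+-monoʳ-< ∣ H ∣ rest<S ⟩
          ∣ H ∣ + ∣ S ∣                  ∎)
        where
        open ℕ.≤-Reasoning
        H : GSubset
        H = stabiliser rest

        H≤G : IsSubgroup H
        H≤G = stabiliser-subgroup rest

        rest<S : ∣ rest ∣ < ∣ S ∣
        rest<S = p⊂q⇒∣p∣<∣q∣ (p∩q⊆p S _ , p , p∈S , λ p∈ → proj₂ (rest⁻ p∈) 0<m (sym term-0))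

        α∈H : α ∈ H
        α∈H = ∈-stabiliser⁺ rest-stable

        HS⊆ : H · S ⊆ H · ⁅ p ⁆ ∪ rest
        HS⊆ z∈ with ∈-·⁻ z∈
        ... | h , s , h∈H , s∈S , refl with rest-or-term s∈S
        ... | inj₁ s∈ = q⊆p∪q (H · ⁅ p ⁆) rest (stabiliser-∙ h∈H s∈)
        ... | inj₂ (i , refl) = p⊆p∪q rest (subst (_∈ H · ⁅ p ⁆) (assoc h _ p)
          (∈-·⁺ (subgroup-∙ H≤G h∈H (subgroup-^ H≤G (subgroup-⁻¹ H≤G α∈H) (toℕ i))) (x∈⁅x⁆ p)))

    conclusion : Progression S ⊎ NearlyPeriodic S
    conclusion with (α ◃ S) ⊆? S
    ... | yes αS⊆S = inj₂ (periodic αS⊆S)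
    ... | no αS⊈S with ⊈⇒∃∉ (α ◃ S) S αS⊈S
    ... | y , y∈αS , y∉S with nonempty? (rest p∈S αp∉S)
      where
      p∈S : α ⁻¹ ∙ y ∈ S
      p∈S = ∈-◃⁻ y∈αS
      αp∉S : α ∙ (α ⁻¹ ∙ y) ∉ S
      αp∉S = y∉S ∘ subst (_∈ S) (\\-leftDividesˡ α y)
    ... | yes some = inj₂ (rest⇒nearlyPeriodic _ _ some)
    ... | no none = inj₁ (no-rest⇒progression _ _ none)

  -- Fragments.

  ∈-∪·⁻ : ∀ {X Y S z} → z ∈ (X ∪ Y) · S → z ∈ X · S ∪ Y · S
  ∈-∪·⁻ {X} {Y} {S} z∈ with ∈-·⁻ z∈
  ... | x , s , x∈ , s∈S , refl = x∈p∪q⁺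
    ([ (λ x∈X → inj₁ (∈-·⁺ x∈X s∈S)) , (λ x∈Y → inj₂ (∈-·⁺ x∈Y s∈S)) ]′ (x∈p∪q⁻ X Y x∈))

  submodular : ∀ X Y S → ∣ (X ∪ Y) · S ∣ + ∣ (X ∩ Y) · S ∣ ≤ ∣ X · S ∣ + ∣ Y · S ∣
  submodular X Y S = begin
    ∣ (X ∪ Y) · S ∣ + ∣ (X ∩ Y) · S ∣          ≤⟨ +-mono-≤
      (p⊆q⇒∣p∣≤∣q∣ (∈-∪·⁻ {X} {Y} {S}))
      (p⊆q⇒∣p∣≤∣q∣ λ z∈ → x∈p∩q⁺ (·-monoˡ S (p∩q⊆p X Y) z∈ , ·-monoˡ S (p∩q⊆q X Y) z∈)) ⟩
    ∣ X · S ∪ Y · S ∣ + ∣ (X · S) ∩ (Y · S) ∣    ≡⟨ ∣p∪q∣+∣p∩q∣≡∣p∣+∣q∣ (X · S) (Y · S) ⟩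
    ∣ X · S ∣ + ∣ Y · S ∣                      ∎
    where open ℕ.≤-Reasoning

  -- X has at least two elements, and so has the complement of XS.
  Admissible : GSubset → GSubset → Set
  Admissible S X = 2 ≤ ∣ X ∣ × 2 + ∣ X · S ∣ ≤ order

  -- κ bounds |XS| - |X| from below over the admissible X.
  IsLowerBound : GSubset → ℕ → Set
  IsLowerBound S κ = ∀ X → Admissible S X → ∣ X ∣ + κ ≤ ∣ X · S ∣

  -- X attains the bound κ; the other inequality is part of κ being a lower bound.
  IsFragment : GSubset → ℕ → GSubset → Set
  IsFragment S κ X = Admissible S X × ∣ X · S ∣ ≤ ∣ X ∣ + κ

  module _ {S κ} (κ<S : κ < ∣ S ∣) (lower : IsLowerBound S κ) where

    -- The bound extends to singletons, as κ < |S|, and to sets X with XS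
    -- missing a single y, as X⁻¹y is then disjoint from S.
    nonempty-bound : ∀ {X} → Nonempty X → ∣ X · S ∣ < order → ∣ X ∣ + κ ≤ ∣ X · S ∣
    nonempty-bound {X} X≠∅ XS<n with 2 ≤? ∣ X ∣ | 2 + ∣ X · S ∣ ≤? order
    ... | no X≱2  | _       = begin
      ∣ X ∣ + κ   ≤⟨ +-monoˡ-≤ κ (ℕ.≤-pred (≰⇒> X≱2)) ⟩
      suc κ       ≤⟨ κ<S ⟩
      ∣ S ∣       ≤⟨ ∣S∣≤∣X·S∣ X≠∅ ⟩
      ∣ X · S ∣   ∎
      where open ℕ.≤-Reasoning
    ... | yes X≥2 | yes room = lower X (X≥2 , room)
    ... | yes X≥2 | no full with ∣p∣<n⇒∃∉ (X · S) XS<n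
    ... | y , y∉XS = ℕ.≤-pred (begin
      suc (∣ X ∣ + κ)    ≡⟨ ℕ.+-suc ∣ X ∣ κ ⟨
      ∣ X ∣ + suc κ      ≤⟨ +-mono-≤ X≤∁S κ<S ⟩
      ∣ ∁ S ∣ + ∣ S ∣    ≡⟨ trans (ℕ.+-comm ∣ ∁ S ∣ ∣ S ∣) (∣p∣+∣∁p∣≡n S) ⟩
      order              ≤⟨ ℕ.≤-pred (≰⇒> full) ⟩
      suc ∣ X · S ∣      ∎)
      where
      open ℕ.≤-Reasoning
      X≤∁S : ∣ X ∣ ≤ ∣ ∁ S ∣
      X≤∁S = injection⇒∣p∣≤∣q∣ (λ x → x ⁻¹ ∙ y)
        (λ {x} x∈X → x∉p⇒x∈∁p λ x⁻¹y∈S → y∉XS (subst (_∈ X · S) (\\-leftDividesˡ x y) (∈-·⁺ x∈X x⁻¹y∈S)))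
        (λ eq → ⁻¹-injective (∙-cancelʳ y _ _ eq))

  translate-fragment : ∀ {S κ X} g → IsFragment S κ X → IsFragment S κ (g ◃ X)
  translate-fragment {S} {κ} {X} g ((X≥2 , room) , tight) =
    ( subst (2 ≤_) (sym (∣g◃X∣≡∣X∣ g X)) X≥2
    , ≤-trans (+-monoʳ-≤ 2 (∣g◃X·S∣≤∣X·S∣ g X S)) room)
    , ≤-trans (∣g◃X·S∣≤∣X·S∣ g X S) (≤-trans tight (≤-reflexive (cong (_+ κ) (sym (∣g◃X∣≡∣X∣ g X)))))

  closed-fragment⇒nearlyPeriodic : ∀ {S κ X} → κ < ∣ S ∣ → IsFragment S κ X → ε ∈ X →
    (∀ {x y} → x ∈ X → y ∈ X → x ∙ y ∈ X) → NearlyPeriodic S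
  closed-fragment⇒nearlyPeriodic {S} {κ} {X} κ<S ((X≥2 , room) , tight) ε∈X closed =
    X , closed⇒subgroup ε∈X closed , 2≤∣H∣⇒nontrivial X≥2 ,
    ∣H∣<order⇒proper (≤-trans (s≤s (∣X∣≤∣X·S∣ (1≤∣p∣⇒Nonempty S (ℕ.≤-<-trans z≤n κ<S)))) (ℕ.<⇒≤ room)) ,
    ≤-trans tight (ℕ.∸-monoˡ-≤ {suc (∣ X ∣ + κ)} 1
      (≤-trans (≤-reflexive (sym (ℕ.+-suc ∣ X ∣ κ))) (+-monoʳ-≤ ∣ X ∣ κ<S)))

  -- A is a fragment for S no larger than any fragment X for S, and no larger than
  -- the complement of XS, which is a fragment for S⁻¹.
  record IsAtom (S : GSubset) (κ : ℕ) (A : GSubset) : Set where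
    field
      κ<∣S∣    : κ < ∣ S ∣
      lower    : IsLowerBound S κ
      fragment : IsFragment S κ A
      least    : ∀ {X} → IsFragment S κ X → ∣ A ∣ ≤ ∣ X ∣
      coleast  : ∀ {X} → IsFragment S κ X → ∣ A ∣ + ∣ X · S ∣ ≤ order

  translate-atom : ∀ {S κ A} g → IsAtom S κ A → IsAtom S κ (g ◃ A)
  translate-atom {S} {κ} {A} g atom = record
    { κ<∣S∣ = κ<∣S∣ ; lower = lower ; fragment = translate-fragment g fragment
    ; least = λ {X} F → subst (_≤ ∣ X ∣) (sym (∣g◃X∣≡∣X∣ g A)) (least F)
    ; coleast = λ {X} F → subst (λ a → a + ∣ X · S ∣ ≤ order) (sym (∣g◃X∣≡∣X∣ g A)) (coleast F)
    }
    where open IsAtom atom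

  module Atom {S κ A} (atom : IsAtom S κ A) (ε∈A : ε ∈ A) where
    open IsAtom atom

    S≠∅ : Nonempty S
    S≠∅ = 1≤∣p∣⇒Nonempty S (ℕ.≤-<-trans z≤n κ<∣S∣)

    A≥2 : 2 ≤ ∣ A ∣
    A≥2 = proj₁ (proj₁ fragment)

    module _ {X} (F : IsFragment S κ X) (g : Fin order) where

      ∣gA·S∣≤ : ∣ g ◃ A · S ∣ ≤ ∣ A ∣ + κ
      ∣gA·S∣≤ = ≤-trans (∣g◃X·S∣≤∣X·S∣ g A S) (proj₂ fragment)

      ∣gA∪X∣+∣gA∩X∣ : ∣ g ◃ A ∪ X ∣ + ∣ g ◃ A ∩ X ∣ ≡ ∣ A ∣ + ∣ X ∣
      ∣gA∪X∣+∣gA∩X∣ = trans (∣p∪q∣+∣p∩q∣≡∣p∣+∣q∣ (g ◃ A) X) (cong (_+ ∣ X ∣) (∣g◃X∣≡∣X∣ g A))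

      -- Submodularity for gA and X: a large value on the intersection would force
      -- a value below the bound on the union.
      intersection-tight : Nonempty (g ◃ A ∩ X) → ∣ (g ◃ A ∩ X) · S ∣ ≤ ∣ g ◃ A ∩ X ∣ + κ
      intersection-tight I≠∅ with ∣ (g ◃ A ∩ X) · S ∣ ≤? ∣ g ◃ A ∩ X ∣ + κ
      ... | yes tight = tight
      ... | no ¬tight = overlap-arithmetic {u = ∣ g ◃ A ∪ X ∣} {i = ∣ g ◃ A ∩ X ∣} {x = ∣ X ∣} {a = ∣ A ∣}
        (submodular (g ◃ A) X S) ∣gA·S∣≤ (proj₂ F) ∣gA∪X∣+∣gA∩X∣
        (nonempty-bound κ<∣S∣ lower (let x , x∈ = I≠∅ in x , p⊆p∪q X (p∩q⊆p (g ◃ A) X x∈))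
          (≤-trans (s≤s (ℕ.m≤m+n _ _))
            (room-arithmetic {i = ∣ g ◃ A ∩ X ∣} {a = ∣ A ∣} (submodular (g ◃ A) X S) ∣gA·S∣≤ (coleast F) (≰⇒> ¬tight))))

      -- The intersection is then a fragment itself, so it is not smaller than A.
      meet-twice⇒⊆ : 2 ≤ ∣ g ◃ A ∩ X ∣ → g ◃ A ⊆ X
      meet-twice⇒⊆ I≥2 = p∩q⊆q (g ◃ A) X ∘ ∣q∣≤∣p∣⇒q⊆p (p∩q⊆p (g ◃ A) X)
        (≤-trans (≤-reflexive (∣g◃X∣≡∣X∣ g A)) (least ((I≥2 , room) , tight)))
        where
        room : 2 + ∣ (g ◃ A ∩ X) · S ∣ ≤ order
        room = ≤-trans (+-monoʳ-≤ 2 (p⊆q⇒∣p∣≤∣q∣ (·-monoˡ S (p∩q⊆q (g ◃ A) X)))) (proj₂ (proj₁ F))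

        tight : ∣ (g ◃ A ∩ X) · S ∣ ≤ ∣ g ◃ A ∩ X ∣ + κ
        tight = intersection-tight (1≤∣p∣⇒Nonempty _ (ℕ.<⇒≤ I≥2))

      two-common⇒⊆ : ∀ {x y} → x ∈ g ◃ A → x ∈ X → y ∈ g ◃ A → y ∈ X → x ≢ y → g ◃ A ⊆ X
      two-common⇒⊆ x∈gA x∈X y∈gA y∈X x≢y =
        meet-twice⇒⊆ (two-elements⇒2≤∣p∣ (x∈p∩q⁺ (x∈gA , x∈X)) (x∈p∩q⁺ (y∈gA , y∈X)) x≢y)

      -- When κ + 1 < |S| a single common point suffices: if I = {x} were the
      -- intersection, |IS| = |S| would exceed |I| + κ.
      meet-once⇒⊆ : suc κ < ∣ S ∣ → Nonempty (g ◃ A ∩ X) → g ◃ A ⊆ X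
      meet-once⇒⊆ κ+1<S I≠∅ = meet-twice⇒⊆ (≤-pred-+ (begin
        2 + κ                      ≤⟨ κ+1<S ⟩
        ∣ S ∣                      ≤⟨ ∣S∣≤∣X·S∣ I≠∅ ⟩
        ∣ (g ◃ A ∩ X) · S ∣        ≤⟨ intersection-tight I≠∅ ⟩
        ∣ g ◃ A ∩ X ∣ + κ          ∎))
        where
        open ℕ.≤-Reasoning
        ≤-pred-+ : ∀ {i j} → i + κ ≤ j + κ → i ≤ j
        ≤-pred-+ {i} {j} = ℕ.+-cancelʳ-≤ κ i j

      -- The union of X with a translate gA meeting it in one point is a fragment when
      -- |A| + |XS| < |G|.
      module _ (single : ∣ g ◃ A ∩ X ∣ ≡ 1) where

        ∣gA∪X∣+1 : ∣ g ◃ A ∪ X ∣ + 1 ≡ ∣ A ∣ + ∣ X ∣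
        ∣gA∪X∣+1 = trans (cong (∣ g ◃ A ∪ X ∣ +_) (sym single)) ∣gA∪X∣+∣gA∩X∣

        join-fragment : ∣ A ∣ + ∣ X · S ∣ < order → IsFragment S κ (g ◃ A ∪ X)
        join-fragment room = 
            (U≥2 , ≤-trans (s≤s (join-room-arithmetic {a = ∣ A ∣} (submodular (g ◃ A) X S) ∣gA·S∣≤ κ<∣IS∣)) room)
          , join-tight-arithmetic {u = ∣ g ◃ A ∪ X ∣} {x = ∣ X ∣} {a = ∣ A ∣} (submodular (g ◃ A) X S) ∣gA·S∣≤ κ<∣IS∣ ∣gA∪X∣+1 (proj₂ F)
          where
          κ<∣IS∣ : κ < ∣ (g ◃ A ∩ X) · S ∣
          κ<∣IS∣ = ≤-trans κ<∣S∣ (∣S∣≤∣X·S∣ (1≤∣p∣⇒Nonempty _ (≤-reflexive (sym single))))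

          U≥2 : 2 ≤ ∣ g ◃ A ∪ X ∣
          U≥2 = ≤-trans (proj₁ (proj₁ F)) (p⊆q⇒∣p∣≤∣q∣ (q⊆p∪q (g ◃ A) X))

    -- The case κ + 1 < |S|: since xA meets A in x, for each x in A, A is closed under
    -- products.
    non-extremal : suc κ < ∣ S ∣ → NearlyPeriodic S
    non-extremal κ+1<S = closed-fragment⇒nearlyPeriodic κ<∣S∣ fragment ε∈A λ {x} {y} x∈A y∈A →
      meet-once⇒⊆ fragment x κ+1<S (x , x∈p∩q⁺ (subst (_∈ x ◃ A) (identityʳ x) (∙∈◃ ε∈A) , x∈A)) (∙∈◃ y∈A)

    -- The case |A| = 2; only |AS| ≤ |S| + 1 matters.
    two-point-atom : ∣ A ∣ ≤ 2 → Progression S ⊎ NearlyPeriodic S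
    two-point-atom A≤2 with 2≤∣p∣⇒∃≢ A A≥2 ε
    ... | α , α∈A , α≢ε = AlmostPeriodic.conclusion {S} {α} S≠∅
      (≤-trans (s≤s (∣S∣≤∣X·S∣ (ε , ε∈A))) (≤-trans (ℕ.n≤1+n _) (proj₂ (proj₁ fragment)))) α≢ε (begin
        ∣ S ∪ α ◃ S ∣        ≤⟨ p⊆q⇒∣p∣≤∣q∣ S∪αS⊆AS ⟩
        ∣ A · S ∣            ≤⟨ proj₂ fragment ⟩
        ∣ A ∣ + κ            ≤⟨ +-monoˡ-≤ κ A≤2 ⟩
        2 + κ                ≤⟨ s≤s κ<∣S∣ ⟩
        suc ∣ S ∣            ∎)
      where
      open ℕ.≤-Reasoning
      S∪αS⊆AS : S ∪ α ◃ S ⊆ A · S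
      S∪αS⊆AS {z} z∈ with x∈p∪q⁻ S (α ◃ S) z∈
      ... | inj₁ z∈S  = subst (_∈ A · S) (identityˡ z) (∈-·⁺ ε∈A z∈S)
      ... | inj₂ z∈αS = subst (_∈ A · S) (\\-leftDividesˡ α z) (∈-·⁺ α∈A (∈-◃⁻ z∈αS))

  -- Growing a tree of translates.

  module ExtremalAtom {S κ A} (atom : IsAtom S κ A) (ε∈A : ε ∈ A)
    (∣S∣≤ : ∣ S ∣ ≤ suc κ) (A≥3 : 3 ≤ ∣ A ∣) where
    open IsAtom atom
    open Atom atom ε∈A

    -- The left stabiliser of A.
    H : GSubset
    H = stabiliser A

    H≤G : IsSubgroup H
    H≤G = stabiliser-subgroup A

    ◃⊆◃⇒∈H : ∀ {g g′} → g′ ◃ A ⊆ g ◃ A → g ⁻¹ ∙ g′ ∈ H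
    ◃⊆◃⇒∈H {g} {g′} g′A⊆gA = ∈-transporter⁺ λ {x} x∈ →
      ∙∈◃⁻ (g′A⊆gA (subst (λ k → g ∙ x ∈ k ◃ A) (\\-leftDividesˡ g g′) (◃-∙ x∈)))

    meet-≤1 : ∀ {X g} → IsFragment S κ X → ¬ (g ◃ A ⊆ X) → ∣ g ◃ A ∩ X ∣ ≤ 1
    meet-≤1 {X} {g} F gA⊈X = ℕ.≤-pred (≰⇒> λ I≥2 → gA⊈X (meet-twice⇒⊆ F g I≥2))

    -- A translate inside gA ∪ X but not inside X has at most one point in X, so at
    -- least two in gA, and therefore equals gA.
    covered : ∀ {X g g′} → IsFragment S κ X → g′ ◃ A ⊆ g ◃ A ∪ X → ¬ (g′ ◃ A ⊆ X) → g ⁻¹ ∙ g′ ∈ H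
    covered {X} {g} {g′} F g′A⊆ g′A⊈X = ◃⊆◃⇒∈H (meet-twice⇒⊆ (translate-fragment g fragment) g′
      (ℕ.+-cancelʳ-≤ 1 2 _ (begin
        3                                              ≤⟨ A≥3 ⟩
        ∣ A ∣                                          ≡⟨ ∣g◃X∣≡∣X∣ g′ A ⟨
        ∣ g′ ◃ A ∣                                     ≤⟨ p⊆q⇒∣p∣≤∣q∣ split ⟩
        ∣ (g′ ◃ A ∩ g ◃ A) ∪ (g′ ◃ A ∩ X) ∣            ≤⟨ ∣p∪q∣≤∣p∣+∣q∣ (g′ ◃ A ∩ g ◃ A) (g′ ◃ A ∩ X) ⟩
        ∣ g′ ◃ A ∩ g ◃ A ∣ + ∣ g′ ◃ A ∩ X ∣            ≤⟨ +-monoʳ-≤ _ (meet-≤1 F g′A⊈X) ⟩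
        ∣ g′ ◃ A ∩ g ◃ A ∣ + 1                         ∎)))
      where
      open ℕ.≤-Reasoning
      split : g′ ◃ A ⊆ (g′ ◃ A ∩ g ◃ A) ∪ (g′ ◃ A ∩ X)
      split z∈ = x∈p∪q⁺ ([ (λ z∈gA → inj₁ (x∈p∩q⁺ (z∈ , z∈gA))) , (λ z∈X → inj₂ (x∈p∩q⁺ (z∈ , z∈X))) ]′
        (x∈p∪q⁻ (g ◃ A) X (g′A⊆ z∈)))

    -- Z contains every translate of A that it meets.
    TranslateClosed : GSubset → Set
    TranslateClosed Z = ∀ {g z} → z ∈ Z → z ∈ g ◃ A → g ◃ A ⊆ Z

    translate-closed : ∀ {Z} w → TranslateClosed Z → TranslateClosed (w ◃ Z)
    translate-closed w closed z∈wZ z∈gA y∈gA = ∈-◃⁺ (closed (∈-◃⁻ z∈wZ) (◃-∙ z∈gA) (◃-∙ y∈gA))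

    -- The properties used of a fragment formed from A by adjoining i translates of
    -- A one at a time, each meeting the union of the earlier ones in one point. It
    -- contains no translates of A but the i + 1 used to build it, each of them equal to gA
    -- for |H| elements g; this is count. Any translate-closed set containing 1
    -- contains all of it; this is connected.
    record Tree (X : GSubset) (i : ℕ) : Set where
      field
        isFragment : IsFragment S κ X
        size       : ∣ X ∣ + i ≡ suc i * ∣ A ∣
        count      : ∣ transporter A X ∣ ≤ suc i * ∣ H ∣
        ε∈         : ε ∈ X
        connected  : ∀ {Z} → TranslateClosed Z → ε ∈ Z → X ⊆ Z

    one-translate : Tree A 0
    one-translate = record
      { isFragment = fragment
      ; size       = refl
      ; count      = ≤-reflexive (sym (ℕ.+-identityʳ ∣ H ∣))
      ; ε∈         = ε∈A
      ; connected  = λ {Z} closed ε∈Z {x} x∈A → subst (_∈ Z) (identityˡ x)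
          (closed ε∈Z (subst (_∈ ε ◃ A) (identityˡ ε) (∙∈◃ ε∈A)) (∙∈◃ x∈A))
      }

    adjoin : ∀ {X i g} → Tree X i → ∣ g ◃ A ∩ X ∣ ≡ 1 → ∣ A ∣ + ∣ X · S ∣ < order → Tree (g ◃ A ∪ X) (suc i)
    adjoin {X} {i} {g} tree single room = record
      { isFragment = join-fragment isFragment g single room
      ; size       = trans (sym (ℕ.+-assoc ∣ U ∣ 1 i)) (trans (cong (_+ i) (∣gA∪X∣+1 isFragment g single))
          (trans (ℕ.+-assoc ∣ A ∣ ∣ X ∣ i) (cong (∣ A ∣ +_) size)))
      ; count      = begin
          ∣ transporter A U ∣                    ≤⟨ p⊆q⇒∣p∣≤∣q∣ transporter⊆ ⟩
          ∣ g ◃ H ∪ transporter A X ∣            ≤⟨ ∣p∪q∣≤∣p∣+∣q∣ (g ◃ H) (transporter A X) ⟩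
          ∣ g ◃ H ∣ + ∣ transporter A X ∣        ≤⟨ +-mono-≤ (≤-reflexive (∣g◃X∣≡∣X∣ g H)) count ⟩
          ∣ H ∣ + suc i * ∣ H ∣                  ∎
      ; ε∈         = q⊆p∪q (g ◃ A) X ε∈
      ; connected  = λ closed ε∈Z z∈ →
          let x , x∈gA∩X = 1≤∣p∣⇒Nonempty (g ◃ A ∩ X) (≤-reflexive (sym single))
              x∈gA , x∈X = x∈p∩q⁻ (g ◃ A) X x∈gA∩X
          in [ closed (connected closed ε∈Z x∈X) x∈gA , connected closed ε∈Z ]′ (x∈p∪q⁻ (g ◃ A) X z∈)
      }
      where
      open Tree tree
      open ℕ.≤-Reasoning
      U : GSubset
      U = g ◃ A ∪ X

      transporter⊆ : transporter A U ⊆ g ◃ H ∪ transporter A X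
      transporter⊆ {g′} g′∈ with (g′ ◃ A) ⊆? X
      ... | yes g′A⊆X = q⊆p∪q (g ◃ H) (transporter A X) (∈-transporter⁺ g′A⊆X)
      ... | no g′A⊈X  = p⊆p∪q (transporter A X) (∈-◃⁺ (covered isFragment (∈-transporter⁻ g′∈) g′A⊈X))

    -- For x in X the translate x⁻¹X is translate-closed and contains 1, so it
    -- contains X.
    closed-tree⇒nearlyPeriodic : ∀ {X i} → Tree X i → TranslateClosed X → NearlyPeriodic S
    closed-tree⇒nearlyPeriodic {X} tree closed = closed-fragment⇒nearlyPeriodic κ<∣S∣ isFragment ε∈
      λ {x} {y} x∈X y∈X → subst (λ w → w ∙ y ∈ X) (⁻¹-involutive x)
        (∈-◃⁻ (connected (translate-closed (x ⁻¹) closed)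
          (∈-◃⁺ (subst (_∈ X) (sym (trans (identityʳ _) (⁻¹-involutive x))) x∈X)) y∈X))
      where open Tree tree

    -- There is a tree too large for the union with a further translate to be a
    -- fragment.
    Maximal : Set
    Maximal = ∃₂ λ X i → Tree X i × ∣ A ∣ + ∣ X · S ∣ ≡ order

    -- Adjoin translates as long as possible; fuel bounds the number of elements
    -- outside the tree.
    grow : ∀ fuel {X i} → Tree X i → order ≤ fuel + ∣ X ∣ → Maximal ⊎ NearlyPeriodic S
    grow zero {X} tree n≤X = ⊥-elim
      (ℕ.<⇒≱ (ℕ.<-≤-trans (s≤s (∣X∣≤∣X·S∣ S≠∅)) (ℕ.<⇒≤ (proj₂ (proj₁ (Tree.isFragment tree))))) n≤X)
    grow (suc fuel) {X} {i} tree n≤ with ℕ.m≤n⇒m<n∨m≡n (coleast (Tree.isFragment tree))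
    ... | inj₂ full = inj₁ (X , i , tree , full)
    ... | inj₁ room with any? (λ g → ∣ g ◃ A ∩ X ∣ ℕ.≟ 1)
    ... | yes (g , single) = grow fuel (adjoin tree single room) (begin
      order                         ≤⟨ n≤ ⟩
      suc fuel + ∣ X ∣              ≡⟨ ℕ.+-suc fuel ∣ X ∣ ⟨
      fuel + suc ∣ X ∣              ≤⟨ +-monoʳ-≤ fuel X<U ⟩
      fuel + ∣ g ◃ A ∪ X ∣          ∎)
      where
      open ℕ.≤-Reasoning
      X<U : ∣ X ∣ < ∣ g ◃ A ∪ X ∣
      X<U = ℕ.+-cancelʳ-≤ 1 _ _ (begin
        suc ∣ X ∣ + 1               ≡⟨ ℕ.+-comm (suc ∣ X ∣) 1 ⟩
        2 + ∣ X ∣                   ≤⟨ +-monoˡ-≤ ∣ X ∣ A≥2 ⟩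
        ∣ A ∣ + ∣ X ∣               ≡⟨ ∣gA∪X∣+1 (Tree.isFragment tree) g single ⟨
        ∣ g ◃ A ∪ X ∣ + 1           ∎)
    ... | no none = inj₂ (closed-tree⇒nearlyPeriodic tree λ {g} {z} z∈X z∈gA →
      meet-twice⇒⊆ (Tree.isFragment tree) g
        (ℕ.≤∧≢⇒< (Nonempty⇒1≤∣p∣ (z , x∈p∩q⁺ (z∈gA , z∈X))) (λ 1≡ → none (g , sym 1≡))))

    -- Choose y outside XS. The elements g with g⁻¹y outside AS are at least |X| in
    -- number; for such g both gA and X lie in the window yC⁻¹, C the complement
    -- of S, which has at most |A| + |X| - 1 elements. If gA is not inside X then it fills
    -- the rest of the window, so all such g give the same translate.
    maximal-bound : ∀ {X i} → Tree X i → ∣ A ∣ + ∣ X · S ∣ ≡ order → ∣ X ∣ ≤ suc (suc i) * ∣ H ∣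
    maximal-bound {X} {i} tree full = ≤-trans X≤M M≤
      where
      open Tree tree
      open ℕ.≤-Reasoning

      outside-XS : ∃[ y ] y ∉ X · S
      outside-XS = ∣p∣<n⇒∃∉ (X · S) (subst (∣ X · S ∣ <_) full (+-monoˡ-≤ ∣ X · S ∣ (ℕ.<⇒≤ A≥2)))

      y : Fin order
      y = proj₁ outside-XS

      inM? : ∀ g → Dec (g ⁻¹ ∙ y ∉ A · S)
      inM? g = ¬? ((g ⁻¹ ∙ y) ∈? A · S)

      M : GSubset
      M = comprehension inM?

      X≤M : ∣ X ∣ ≤ ∣ M ∣
      X≤M = ≤-trans
        (complement-arithmetic (∣p∣+∣∁p∣≡n (A · S)) full (lower X (proj₁ isFragment)) (proj₂ fragment))
        (injection⇒∣p∣≤∣q∣ (λ z → y ∙ z ⁻¹)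
          (λ {z} z∈ → ∈-comprehension⁺ inM? (subst (_∉ A · S) (sym (recover z)) (x∈∁p⇒x∉p z∈)))
          (λ eq → ⁻¹-injective (∙-cancelˡ y _ _ eq)))
        where
        recover : ∀ z → (y ∙ z ⁻¹) ⁻¹ ∙ y ≡ z
        recover z = trans (cong (_∙ y) (trans (⁻¹-anti-homo-∙ y (z ⁻¹)) (cong (_∙ y ⁻¹) (⁻¹-involutive z))))
          (//-rightDividesˡ y z)

      inWindow? : ∀ u → Dec (u ⁻¹ ∙ y ∉ S)
      inWindow? u = ¬? ((u ⁻¹ ∙ y) ∈? S)

      window : GSubset
      window = comprehension inWindow?

      window-size : suc ∣ window ∣ ≤ ∣ A ∣ + ∣ X ∣
      window-size = ≤-trans
        (s≤s (injection⇒∣p∣≤∣q∣ (λ u → u ⁻¹ ∙ y)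
          (x∉p⇒x∈∁p ∘ ∈-comprehension⁻ inWindow?) (λ eq → ⁻¹-injective (∙-cancelʳ y _ _ eq))))
        (window-arithmetic (trans (ℕ.+-comm ∣ ∁ S ∣ ∣ S ∣) (∣p∣+∣∁p∣≡n S)) full (proj₂ isFragment) κ<∣S∣)

      X⊆window : X ⊆ window
      X⊆window {u} u∈X = ∈-comprehension⁺ inWindow? λ s∈S →
        proj₂ outside-XS (subst (_∈ X · S) (\\-leftDividesˡ u y) (∈-·⁺ u∈X s∈S))

      gA⊆window : ∀ {g} → g ∈ M → g ◃ A ⊆ window
      gA⊆window {g} g∈M {u} u∈gA = ∈-comprehension⁺ inWindow? λ s∈S →
        ∈-comprehension⁻ inM? g∈M (subst (_∈ A · S)
          (trans (assoc _ _ _) (cong (g ⁻¹ ∙_) (\\-leftDividesˡ u y))) (∈-·⁺ (∈-◃⁻ u∈gA) s∈S))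

      fills-window : ∀ {g} → g ∈ M → ¬ (g ◃ A ⊆ X) → window ⊆ g ◃ A ∪ X
      fills-window {g} g∈M gA⊈X = ∣q∣≤∣p∣⇒q⊆p
        (λ z∈ → [ gA⊆window g∈M , X⊆window ]′ (x∈p∪q⁻ (g ◃ A) X z∈))
        (window-full-arithmetic {a = ∣ A ∣} {x = ∣ X ∣} window-size (∣gA∪X∣+∣gA∩X∣ isFragment g) (meet-≤1 isFragment gA⊈X))

      M≤ : ∣ M ∣ ≤ suc (suc i) * ∣ H ∣
      M≤ with any? (λ g → (g ∈? M) ×-dec ¬? ((g ◃ A) ⊆? X))
      ... | yes (g , g∈M , gA⊈X) = begin
        ∣ M ∣                                  ≤⟨ p⊆q⇒∣p∣≤∣q∣ M⊆ ⟩
        ∣ g ◃ H ∪ transporter A X ∣            ≤⟨ ∣p∪q∣≤∣p∣+∣q∣ (g ◃ H) (transporter A X) ⟩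
        ∣ g ◃ H ∣ + ∣ transporter A X ∣        ≤⟨ +-mono-≤ (≤-reflexive (∣g◃X∣≡∣X∣ g H)) count ⟩
        ∣ H ∣ + suc i * ∣ H ∣                  ∎
        where
        M⊆ : M ⊆ g ◃ H ∪ transporter A X
        M⊆ {g′} g′∈M with (g′ ◃ A) ⊆? X
        ... | yes g′A⊆X = q⊆p∪q (g ◃ H) (transporter A X) (∈-transporter⁺ g′A⊆X)
        ... | no g′A⊈X  = p⊆p∪q (transporter A X)
          (∈-◃⁺ (covered isFragment (fills-window g∈M gA⊈X ∘ gA⊆window g′∈M) g′A⊈X))
      ... | no none = ≤-trans (p⊆q⇒∣p∣≤∣q∣ M⊆) (≤-trans count (ℕ.m≤n+m _ ∣ H ∣))
        where
        M⊆ : M ⊆ transporter A X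
        M⊆ {g} g∈M with (g ◃ A) ⊆? X
        ... | yes gA⊆X = ∈-transporter⁺ gA⊆X
        ... | no gA⊈X  = contradiction (g , g∈M , gA⊈X) none

    -- With 2|H| ≤ |A| the preceding bound leaves only the tree A itself, and then
    -- |A| ≤ 2|H|.
    exceptional-size : ∣ H ∣ + ∣ H ∣ ≤ ∣ A ∣ → Maximal →
      ∣ A ∣ ≤ ∣ H ∣ + ∣ H ∣ × ∣ A ∣ + (∣ A ∣ + κ) ≡ order
    exceptional-size 2H≤A (X , i , tree , full) =
      single-translate tree full (no-translate-adjoined i
        (tree-arithmetic {i} {∣ X ∣} {∣ A ∣} {∣ H ∣} (Tree.size tree) (maximal-bound tree full) 2H≤A))
      where
      no-translate-adjoined : ∀ i → i * ∣ A ∣ ≤ i * 2 → i ≡ 0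
      no-translate-adjoined zero    _ = refl
      no-translate-adjoined (suc i) h = contradiction A≥3 (ℕ.≤⇒≯ (ℕ.*-cancelˡ-≤ (suc i) h))

      single-translate : ∀ {X i} → Tree X i → ∣ A ∣ + ∣ X · S ∣ ≡ order → i ≡ 0 →
        ∣ A ∣ ≤ ∣ H ∣ + ∣ H ∣ × ∣ A ∣ + (∣ A ∣ + κ) ≡ order
      single-translate {X} tree full refl = A≤2H , (begin-equality
        ∣ A ∣ + (∣ A ∣ + κ)      ≡⟨ cong (λ k → ∣ A ∣ + (k + κ)) ∣X∣≡∣A∣ ⟨
        ∣ A ∣ + (∣ X ∣ + κ)      ≡⟨ cong (∣ A ∣ +_) (≤-antisym (lower X (proj₁ isFragment)) (proj₂ isFragment)) ⟩
        ∣ A ∣ + ∣ X · S ∣        ≡⟨ full ⟩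
        order                    ∎)
        where
        open Tree tree
        open ℕ.≤-Reasoning
        ∣X∣≡∣A∣ : ∣ X ∣ ≡ ∣ A ∣
        ∣X∣≡∣A∣ = trans (sym (ℕ.+-identityʳ ∣ X ∣)) (trans size (ℕ.+-identityʳ ∣ A ∣))

        A≤2H : ∣ A ∣ ≤ ∣ H ∣ + ∣ H ∣
        A≤2H = begin
          ∣ A ∣                     ≡⟨ ∣X∣≡∣A∣ ⟨
          ∣ X ∣                     ≤⟨ maximal-bound tree full ⟩
          ∣ H ∣ + (∣ H ∣ + 0)       ≡⟨ cong (∣ H ∣ +_) (ℕ.+-identityʳ ∣ H ∣) ⟩
          ∣ H ∣ + ∣ H ∣             ∎

    H⊆A : H ⊆ A
    H⊆A {g} g∈H = subst (_∈ A) (identityʳ g) (stabiliser-∙ g∈H ε∈A)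

    module _ {x} (x∈A : x ∈ A) (x∉H : x ∉ H) where

      Hx⊆A : H · ⁅ x ⁆ ⊆ A
      Hx⊆A z∈ with ∈-·⁻ z∈
      ... | h , k , h∈H , k∈x , refl rewrite x∈⁅y⁆⇒x≡y x k∈x = stabiliser-∙ h∈H x∈A

      H∪Hx⊆A : H ∪ H · ⁅ x ⁆ ⊆ A
      H∪Hx⊆A z∈ = [ H⊆A , Hx⊆A ]′ (x∈p∪q⁻ H (H · ⁅ x ⁆) z∈)

      -- The cosets H and Hx are disjoint.
      ∣H∪Hx∣ : ∣ H ∪ H · ⁅ x ⁆ ∣ ≡ ∣ H ∣ + ∣ H ∣
      ∣H∪Hx∣ = begin
        ∣ H ∪ H · ⁅ x ⁆ ∣                          ≡⟨ ℕ.+-identityʳ _ ⟨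
        ∣ H ∪ H · ⁅ x ⁆ ∣ + 0                      ≡⟨ cong (∣ H ∪ H · ⁅ x ⁆ ∣ +_) (sym disjoint) ⟩
        ∣ H ∪ H · ⁅ x ⁆ ∣ + ∣ H ∩ (H · ⁅ x ⁆) ∣    ≡⟨ ∣p∪q∣+∣p∩q∣≡∣p∣+∣q∣ H (H · ⁅ x ⁆) ⟩
        ∣ H ∣ + ∣ H · ⁅ x ⁆ ∣                      ≡⟨ cong (∣ H ∣ +_) (∣X·⁅x⁆∣≡∣X∣ H x) ⟩
        ∣ H ∣ + ∣ H ∣                              ∎
        where
        open ≡-Reasoning
        x∈H : ∀ {z} → z ∈ H ∩ (H · ⁅ x ⁆) → x ∈ H
        x∈H {z} z∈ with x∈p∩q⁻ H (H · ⁅ x ⁆) z∈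
        ... | z∈H , z∈Hx with ∈-·⁻ z∈Hx
        ... | h , k , h∈H , k∈x , refl rewrite x∈⁅y⁆⇒x≡y x k∈x =
          subst (_∈ H) (\\-leftDividesʳ h x) (subgroup-∙ H≤G (subgroup-⁻¹ H≤G h∈H) z∈H)

        disjoint : ∣ H ∩ (H · ⁅ x ⁆) ∣ ≡ 0
        disjoint = ℕ.n≤0⇒n≡0 (injection⇒∣p∣≤m (λ z∈ → ⊥-elim (x∉H (x∈H z∈)))
          (λ z∈ → ⊥-elim (x∉H (x∈H z∈))))

      -- H ∩ x⁻¹Hx is contained in A ∩ x⁻¹A, which has one element as x is not in H.
      conjugate-trivial : ∀ {u w} → u ∈ H → w ∈ H → u ∙ x ≡ x ∙ w → w ≡ ε
      conjugate-trivial {u} {w} u∈H w∈H ux≡xw with w ≟ ε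
      ... | yes w≡ε = w≡ε
      ... | no w≢ε  = contradiction (subst (_∈ H) (⁻¹-involutive x) (subgroup-⁻¹ H≤G x⁻¹∈H)) x∉H
        where
        x⁻¹∈H : x ⁻¹ ∈ H
        x⁻¹∈H = ∈-transporter⁺ (two-common⇒⊆ fragment (x ⁻¹) (in-translate (Hx-step u∈H ux≡xw)) (H⊆A w∈H)
          (in-translate (subst (_∈ A) (sym (identityʳ x)) x∈A)) ε∈A w≢ε)
          where
          Hx-step : ∀ {u w} → u ∈ H → u ∙ x ≡ x ∙ w → x ∙ w ∈ A
          Hx-step u∈H eq = subst (_∈ A) eq (stabiliser-∙ u∈H x∈A)

          in-translate : ∀ {z} → x ∙ z ∈ A → z ∈ x ⁻¹ ◃ A
          in-translate {z} xz∈A = ∈-◃⁺ (subst (λ k → k ∙ z ∈ A) (sym (⁻¹-involutive x)) xz∈A)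

      ∣HxH∣ : ∣ H · ⁅ x ⁆ · H ∣ ≡ ∣ H ∣ * ∣ H ∣
      ∣HxH∣ = trans (∣X·Y∣≡∣X∣*∣Y∣ (H · ⁅ x ⁆) H unique) (cong (_* ∣ H ∣) (∣X·⁅x⁆∣≡∣X∣ H x))
        where
        unique : ∀ {i i′ j j′} → i ∈ H · ⁅ x ⁆ → i′ ∈ H · ⁅ x ⁆ → j ∈ H → j′ ∈ H →
          i ∙ j ≡ i′ ∙ j′ → i ≡ i′ × j ≡ j′
        unique {i} {i′} {j} {j′} i∈ i′∈ j∈H j′∈H ij≡i′j′ with ∈-·⁻ i∈ | ∈-·⁻ i′∈
        ... | h , k , h∈H , k∈x , refl | h′ , k′ , h′∈H , k′∈x , refl
          rewrite x∈⁅y⁆⇒x≡y x k∈x | x∈⁅y⁆⇒x≡y x k′∈x =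
          ∙-cancelʳ j _ _ (trans ij≡i′j′ (cong (h′ ∙ x ∙_) (sym j≡j′))) , j≡j′
          where
          open ≡-Reasoning
          hx≡h′xj′j⁻¹ : h ∙ x ≡ h′ ∙ (x ∙ (j′ ∙ j ⁻¹))
          hx≡h′xj′j⁻¹ = begin
            h ∙ x                          ≡⟨ //-rightDividesʳ j (h ∙ x) ⟨
            h ∙ x ∙ j ∙ j ⁻¹               ≡⟨ cong (_∙ j ⁻¹) ij≡i′j′ ⟩
            h′ ∙ x ∙ j′ ∙ j ⁻¹             ≡⟨ assoc _ _ _ ⟩
            h′ ∙ x ∙ (j′ ∙ j ⁻¹)           ≡⟨ assoc _ _ _ ⟩
            h′ ∙ (x ∙ (j′ ∙ j ⁻¹))         ∎

          j≡j′ : j ≡ j′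
          j≡j′ = begin
            j                   ≡⟨ identityˡ j ⟨
            ε ∙ j               ≡⟨ cong (_∙ j) j′j⁻¹≡ε ⟨
            j′ ∙ j ⁻¹ ∙ j       ≡⟨ //-rightDividesˡ j j′ ⟩
            j′                  ∎
            where
            j′j⁻¹≡ε : j′ ∙ j ⁻¹ ≡ ε
            j′j⁻¹≡ε = conjugate-trivial (subgroup-∙ H≤G (subgroup-⁻¹ H≤G h′∈H) h∈H)
              (subgroup-∙ H≤G j′∈H (subgroup-⁻¹ H≤G j∈H))
              (trans (assoc _ _ _) (trans (cong (h′ ⁻¹ ∙_) hx≡h′xj′j⁻¹) (\\-leftDividesʳ h′ _)))

    maximal⇒exceptional : ∀ {x} → x ∈ A → x ∉ H → Maximal → Exceptional S
    maximal⇒exceptional {x} x∈A x∉H maximal = H , x , H≤G , ∣HxH∣ x∈A x∉H ,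
      subst (λ B → ∣ B · S ∣ ≡ ∣ B ∣ + ∣ S ∣ ∸ 1 × ∣ B ∣ + ∣ S ∣ ∸ 1 ≡ order ∸ ∣ B ∣) A≡H∪Hx
        (trans ∣AS∣≡ (sym ∣A∣+∣S∣∸1≡) , trans ∣A∣+∣S∣∸1≡ (sym order∸∣A∣≡))
      where
      sizes : ∣ A ∣ ≤ ∣ H ∣ + ∣ H ∣ × ∣ A ∣ + (∣ A ∣ + κ) ≡ order
      sizes = exceptional-size (subst (_≤ ∣ A ∣) (∣H∪Hx∣ x∈A x∉H) (p⊆q⇒∣p∣≤∣q∣ (H∪Hx⊆A x∈A x∉H))) maximal

      A≡H∪Hx : A ≡ H ∪ H · ⁅ x ⁆
      A≡H∪Hx = ⊆-antisym
        (∣q∣≤∣p∣⇒q⊆p (H∪Hx⊆A x∈A x∉H) (≤-trans (proj₁ sizes) (≤-reflexive (sym (∣H∪Hx∣ x∈A x∉H)))))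
        (H∪Hx⊆A x∈A x∉H)

      ∣AS∣≡ : ∣ A · S ∣ ≡ ∣ A ∣ + κ
      ∣AS∣≡ = ≤-antisym (proj₂ fragment) (lower A (proj₁ fragment))

      ∣A∣+∣S∣∸1≡ : ∣ A ∣ + ∣ S ∣ ∸ 1 ≡ ∣ A ∣ + κ
      ∣A∣+∣S∣∸1≡ = cong (_∸ 1) (trans (cong (∣ A ∣ +_) (≤-antisym ∣S∣≤ κ<∣S∣)) (ℕ.+-suc ∣ A ∣ κ))

      order∸∣A∣≡ : order ∸ ∣ A ∣ ≡ ∣ A ∣ + κ
      order∸∣A∣≡ = trans (cong (_∸ ∣ A ∣) (sym (proj₂ sizes))) (ℕ.m+n∸m≡n ∣ A ∣ _)

    -- If A is contained in H it is closed under products, so a subgroup.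
    extremal : NearlyPeriodic S ⊎ Exceptional S
    extremal with A ⊆? H
    ... | yes A⊆H = inj₁ (closed-fragment⇒nearlyPeriodic κ<∣S∣ fragment ε∈A λ x∈A → stabiliser-∙ (A⊆H x∈A))
    ... | no A⊈H =
      let x , x∈A , x∉H = ⊈⇒∃∉ A H A⊈H
      in [ inj₂ ∘ maximal⇒exceptional x∈A x∉H , inj₁ ]′ (grow order one-translate (ℕ.m≤m+n order ∣ A ∣))

  -- The trichotomy for S itself, not allowing S⁻¹ in place of S.
  Outcome : GSubset → Set c
  Outcome S = Progression S ⊎ NearlyPeriodic S ⊎ Exceptional S

  atom⇒outcome : ∀ {S κ A} → IsAtom S κ A → Outcome S
  atom⇒outcome {S} {κ} {A} atom with 1≤∣p∣⇒Nonempty A (ℕ.<⇒≤ (proj₁ (proj₁ (IsAtom.fragment atom))))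
  ... | x , x∈A = cases (translate-atom (x ⁻¹) atom) (subst (_∈ x ⁻¹ ◃ A) (inverseˡ x) (∙∈◃ x∈A))
    where
    cases : ∀ {A} → IsAtom S κ A → ε ∈ A → Outcome S
    cases {A} atom ε∈A with ∣ S ∣ ≤? suc κ | 3 ≤? ∣ A ∣
    ... | no S≰  | _       = inj₂ (inj₁ (Atom.non-extremal atom ε∈A (≰⇒> S≰)))
    ... | yes _  | no A≱3  = [ inj₁ , inj₂ ∘ inj₁ ]′ (Atom.two-point-atom atom ε∈A (ℕ.≤-pred (≰⇒> A≱3)))
    ... | yes S≤ | yes A≥3 = inj₂ (ExtremalAtom.extremal atom ε∈A S≤ A≥3)

  -- Duality between S and S⁻¹.

  -- If y is outside XS and s⁻¹ is in S, then ys is outside X, as y = (ys)s⁻¹.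
  complement-product : ∀ {S S′} → (∀ {s} → s ∈ S′ → s ⁻¹ ∈ S) → ∀ X → ∁ (X · S) · S′ ⊆ ∁ X
  complement-product {S} {S′} inverse∈S X z∈ with ∈-·⁻ z∈
  ... | y , s , y∈∁ , s∈S′ , refl = x∉p⇒x∈∁p λ ys∈X →
    x∈∁p⇒x∉p y∈∁ (subst (_∈ X · S) (//-rightDividesʳ s y) (∈-·⁺ ys∈X (inverse∈S s∈S′)))

  -- The map from X to the complement of XS takes fragments for S to fragments for S′, and a
  -- lower bound for S′ is one for S, when S′ consists of inverses of elements of S.
  module Dual {S S′} (inverse∈S : ∀ {s} → s ∈ S′ → s ⁻¹ ∈ S) where

    dual-≤ : ∀ X → ∣ ∁ (X · S) · S′ ∣ ≤ ∣ ∁ X ∣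
    dual-≤ X = p⊆q⇒∣p∣≤∣q∣ (complement-product inverse∈S X)

    dual-admissible : ∀ {X} → Admissible S X → Admissible S′ (∁ (X · S))
    dual-admissible {X} (X≥2 , room) =
        dual-size-arithmetic room (∣p∣+∣∁p∣≡n (X · S))
      , dual-room-arithmetic (dual-≤ X) (∣p∣+∣∁p∣≡n X) X≥2

    dual-lower : ∀ {κ} → IsLowerBound S′ κ → IsLowerBound S κ
    dual-lower {κ} lower Y admissible = dual-lower-arithmetic {z = ∣ ∁ (Y · S) ∣} {y = ∣ Y ∣}
      (lower (∁ (Y · S)) (dual-admissible admissible)) (dual-≤ Y) (∣p∣+∣∁p∣≡n Y) (∣p∣+∣∁p∣≡n (Y · S))

    dual-fragment : ∀ {κ X} → IsFragment S κ X → IsFragment S′ κ (∁ (X · S))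
    dual-fragment {κ} {X} (admissible , tight) = dual-admissible admissible ,
      dual-tight-arithmetic {z = ∣ ∁ (X · S) ∣} {x = ∣ X ∣} (dual-≤ X) (∣p∣+∣∁p∣≡n X) (∣p∣+∣∁p∣≡n (X · S)) tight

    smaller⇒atom : ∀ {κ} {A B : GSubset} → κ < ∣ S ∣ → IsLowerBound S κ → IsFragment S κ A →
      (∀ X → IsFragment S κ X → ∣ A ∣ ≤ ∣ X ∣) → (∀ Y → IsFragment S′ κ Y → ∣ B ∣ ≤ ∣ Y ∣) →
      ∣ A ∣ ≤ ∣ B ∣ → IsAtom S κ A
    smaller⇒atom {A = A} {B} κ<S lower fragment least least′ A≤B = record
      { κ<∣S∣ = κ<S ; lower = lower ; fragment = fragment
      ; least = λ {X} → least X
      ; coleast = λ {X} F → coleast-arithmetic {a = ∣ A ∣} (≤-trans A≤B (least′ _ (dual-fragment F))) (∣p∣+∣∁p∣≡n (X · S))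
      }

  admissible? : ∀ S X → Dec (Admissible S X)
  admissible? S X = (2 ≤? ∣ X ∣) ×-dec (2 + ∣ X · S ∣ ≤? order)

  fragment? : ∀ S κ X → Dec (IsFragment S κ X)
  fragment? S κ X = admissible? S X ×-dec (∣ X · S ∣ ≤? ∣ X ∣ + κ)

  -- The minimum κ of |XS| - |X| is at most |TS| - |T|, hence less than |S|. A smallest
  -- fragment for S or a smallest fragment for S⁻¹ is an atom, whichever is smaller.
  outcome : ∀ S T → Nonempty S → Admissible S T → ∣ T · S ∣ ≤ ∣ T ∣ + ∣ S ∣ ∸ 1 →
    Outcome S ⊎ Outcome (inverses S)
  outcome S T S≠∅ T-admissible T-small with minimiser (admissible? S) (λ X → ∣ X · S ∣ ∸ ∣ X ∣) (T , T-admissible)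
  ... | X₀ , X₀-admissible , X₀-min = choose
      (minimiser (fragment? S κ) ∣_∣ (X₀ , X₀-fragment))
      (minimiser (fragment? S′ κ) ∣_∣ (∁ (X₀ · S) , D.dual-fragment X₀-fragment))
    where
    open ℕ.≤-Reasoning
    S′ : GSubset
    S′ = inverses S

    module D  = Dual {S} {S′} ∈-inverses⁻
    module D′ = Dual {S′} {S} ∈-inverses⁺

    κ : ℕ
    κ = ∣ X₀ · S ∣ ∸ ∣ X₀ ∣

    lower : IsLowerBound S κ
    lower Y Y-admissible = begin
      ∣ Y ∣ + κ                          ≤⟨ +-monoʳ-≤ ∣ Y ∣ (X₀-min Y Y-admissible) ⟩
      ∣ Y ∣ + (∣ Y · S ∣ ∸ ∣ Y ∣)        ≡⟨ ℕ.m+[n∸m]≡n (∣X∣≤∣X·S∣ S≠∅) ⟩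
      ∣ Y · S ∣                          ∎

    X₀-fragment : IsFragment S κ X₀
    X₀-fragment = X₀-admissible , ≤-reflexive (sym (ℕ.m+[n∸m]≡n (∣X∣≤∣X·S∣ {X₀} S≠∅)))

    κ<S : κ < ∣ S ∣
    κ<S = begin-strict
      κ                    ≤⟨ ℕ.+-cancelˡ-≤ ∣ T ∣ _ _ (begin
        ∣ T ∣ + κ                ≤⟨ lower T T-admissible ⟩
        ∣ T · S ∣                ≤⟨ T-small ⟩
        ∣ T ∣ + ∣ S ∣ ∸ 1        ≡⟨ ℕ.+-∸-assoc ∣ T ∣ (Nonempty⇒1≤∣p∣ S≠∅) ⟩
        ∣ T ∣ + (∣ S ∣ ∸ 1)      ∎) ⟩
      ∣ S ∣ ∸ 1            <⟨ ≤-refl ⟩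
      suc (∣ S ∣ ∸ 1)      ≡⟨ ℕ.m+[n∸m]≡n (Nonempty⇒1≤∣p∣ S≠∅) ⟩
      ∣ S ∣                ∎

    choose : (∃[ A ] IsFragment S κ A × (∀ X → IsFragment S κ X → ∣ A ∣ ≤ ∣ X ∣)) →
      (∃[ B ] IsFragment S′ κ B × (∀ Y → IsFragment S′ κ Y → ∣ B ∣ ≤ ∣ Y ∣)) →
      Outcome S ⊎ Outcome S′
    choose (A , A-fragment , A-least) (B , B-fragment , B-least) with ℕ.≤-total ∣ A ∣ ∣ B ∣
    ... | inj₁ A≤B = inj₁ (atom⇒outcome (D.smaller⇒atom {B = B} κ<S lower A-fragment A-least B-least A≤B))
    ... | inj₂ B≤A = inj₂ (atom⇒outcome (D′.smaller⇒atom {B = A} (subst (κ <_) (sym (∣inverses∣ S)) κ<S)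
      (D′.dual-lower lower) B-fragment B-least A-least B≤A))
  -- The conclusion for S′ = S or S′ = S⁻¹ in terms of S.

  nearlyPeriodic⇒ : ∀ {S S′ : GSubset} σ → S′ ≡ S 𝔾.^ˢ σ → ∣ S′ ∣ ≡ ∣ S ∣ → NearlyPeriodic S′ →
    ∃[ H ] ∃[ σ ] IsSubgroup H × IsNontrivial H × IsProper H × ∣ H 𝔾.· S 𝔾.^ˢ σ ∣ ≤ ∣ H ∣ + ∣ S ∣ ∸ 1
  nearlyPeriodic⇒ {S} σ refl same (H , H≤G , nontrivial , proper , small) = H , σ , H≤G , nontrivial , proper ,
    subst (λ X → ∣ X ∣ ≤ ∣ H ∣ + ∣ S ∣ ∸ 1) (·≡𝔾· H _)
      (subst (λ s → ∣ H · S 𝔾.^ˢ σ ∣ ≤ ∣ H ∣ + s ∸ 1) same small)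

  exceptional⇒ : ∀ {S S′ : GSubset} σ → S′ ≡ S 𝔾.^ˢ σ → ∣ S′ ∣ ≡ ∣ S ∣ → Exceptional S′ →
    ∃[ H ] ∃[ a ] ∃[ σ ] IsSubgroup H × ∣ H 𝔾.· ｛ a ｝ 𝔾.· H ∣ ≡ ∣ H ∣ * ∣ H ∣
      × (let A = H ∪ H 𝔾.· ｛ a ｝ in
         ∣ A 𝔾.· S 𝔾.^ˢ σ ∣ ≡ ∣ A ∣ + ∣ S ∣ ∸ 1 × ∣ A ∣ + ∣ S ∣ ∸ 1 ≡ order ∸ ∣ A ∣)
  exceptional⇒ {S} σ refl same (H , x , H≤G , ∣HxH∣ , sizes)
    rewrite sym (index-element x) | same | ·≡𝔾· H ｛ element x ｝
      | ·≡𝔾· (H 𝔾.· ｛ element x ｝) H | ·≡𝔾· (H ∪ H 𝔾.· ｛ element x ｝) (S 𝔾.^ˢ σ)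
    = H , element x , σ , H≤G , ∣HxH∣ , sizes

  empty⇒geometric : ∀ {S : GSubset} → ¬ Nonempty S → IsGeometricProgression S
  empty⇒geometric {S} none = progression⇒geometric (ε , ε ,
    (λ x∈S → contradiction (_ , x∈S) none) ,
    (λ i<∣S∣ → contradiction (1≤∣p∣⇒Nonempty S (ℕ.≤-<-trans z≤n i<∣S∣)) none))

theorem1 : ∀ {c ℓ} (G : FiniteGroup c ℓ) → let open FiniteGroupSubsets G in
    (S : GSubset) →
    (∃[ T ] 2 ≤ ∣ T ∣ × ∣ T · S ∣ ≤ (order ∸ 2) ⊓ (∣ T ∣ + ∣ S ∣ ∸ 1)) →
    IsGeometricProgression S
    ⊎ (∃[ H ] ∃[ σ ] IsSubgroup H × IsNontrivial H × IsProper H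
    × ∣ H · S ^ˢ σ ∣ ≤ ∣ H ∣ + ∣ S ∣ ∸ 1)
    ⊎ (∃[ H ] ∃[ a ] ∃[ σ ] IsSubgroup H
    × ∣ H · ｛ a ｝ · H ∣ ≡ ∣ H ∣ * ∣ H ∣
    × (let A = H ∪ H · ｛ a ｝ in
    ∣ A · S ^ˢ σ ∣ ≡ ∣ A ∣ + ∣ S ∣ ∸ 1
    × ∣ A ∣ + ∣ S ∣ ∸ 1 ≡ order ∸ ∣ A ∣))
theorem1 G S (T , T≥2 , small) with nonempty? S
... | no none = inj₁ (FiniteGroupTheory.empty⇒geometric G none)
... | yes S≠∅ = [ for-S , for-S⁻¹ ]′ (outcome S T S≠∅ (T≥2 , room) (subst (_≤ _) ∣TS∣ (ℕ.m≤n⊓o⇒m≤o _ _ small)))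
  where
  open FiniteGroupTheory G

  ∣TS∣ : ∣ T 𝔾.· S ∣ ≡ ∣ T · S ∣
  ∣TS∣ = cong ∣_∣ (sym (·≡𝔾· T S))

  room : 2 + ∣ T · S ∣ ≤ order
  room = begin
    2 + ∣ T · S ∣        ≡⟨ cong (2 +_) ∣TS∣ ⟨
    2 + ∣ T 𝔾.· S ∣      ≤⟨ +-monoʳ-≤ 2 (ℕ.m≤n⊓o⇒m≤n (order ∸ 2) _ small) ⟩
    2 + (order ∸ 2)      ≡⟨ ℕ.m+[n∸m]≡n (≤-trans T≥2 (∣p∣≤n T)) ⟩
    order                ∎
    where open ℕ.≤-Reasoning

  for-S : Outcome S → _
  for-S (inj₁ progression)        = inj₁ (progression⇒geometric progression)
  for-S (inj₂ (inj₁ periodic))    = inj₂ (inj₁ (nearlyPeriodic⇒ Sign.+ refl refl periodic))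
  for-S (inj₂ (inj₂ exceptional)) = inj₂ (inj₂ (exceptional⇒ Sign.+ refl refl exceptional))

  for-S⁻¹ : Outcome (inverses S) → _
  for-S⁻¹ (inj₁ progression)        = inj₁ (progression-inverses⇒geometric progression)
  for-S⁻¹ (inj₂ (inj₁ periodic))    =
    inj₂ (inj₁ (nearlyPeriodic⇒ Sign.- (inverses≡𝔾inverses S) (∣inverses∣ S) periodic))
  for-S⁻¹ (inj₂ (inj₂ exceptional)) =
    inj₂ (inj₂ (exceptional⇒ Sign.- (inverses≡𝔾inverses S) (∣inverses∣ S) exceptional))
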